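{- Any (possibly randomized) online algorithm for the online degree-bounded Steiner tree problem has (multiplicative) competitive ratio $\Omega(\log n)$, where $n$ is the number of vertices; this holds already when $b_v=1$ for every vertex $v$. That is, there is an absolute constant $c>0$ such that for arbitrarily large $n$ and every online algorithm $A$ there exist a graph on $n$ vertices with all degree bounds equal to $1$, a root, and a terminal sequence such that the expected maximum degree of $A$'s output is at least $c\log n\cdot\mathrm{OPT}$.
   Context: Online degree-bounded Steiner tree: an undirected graph $G$, a root vertex, and degree bounds $b_v$ are given in advance; terminals arrive one by one, and upon arrival of each terminal the online algorithm must add edges (edges are never removed) so that every terminal seen so far is connected to the root. The load of $v$ in a subgraph $H$ is $\deg_H(v)/b_v$; the objective is to minimize the maximum load of the final subgraph. $\mathrm{OPT}$ is the minimum maximum load over all subgraphs connecting all the terminals to the root. The competitive ratio is the worst case of the (expected) maximum load of the algorithm's output divided by $\mathrm{OPT}$. -}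

module Defs where

open import Data.Bool using (Bool; true; false; not; _∧_; _∨_)
import Data.Bool.Properties as Bool
open import Data.Fin using (Fin)
import Data.Fin.Properties as Fin
open import Data.Fin.Subset using (Subset; inside; outside; _∈_; _∪_; _∩_; ⊤; ⊥) renaming (∣_∣ to card)
open import Data.Integer using (+_)
open import Data.List using (List; []; _∷_; foldr; map; allFin)
open import Data.List.Relation.Unary.All using (All)
open import Data.Nat using (ℕ; zero; suc; NonZero)
import Data.Nat as ℕ
import Data.Nat.Properties as ℕ
open import Data.Product using (∃; _×_; _,_; proj₁; proj₂)
open import Data.Rational using (ℚ; 0ℚ; 1ℚ; ½; _/_; _+_; _*_; _-_; 1/_; ∣_∣; _≤_; _<_; _⊔_; positive; Positive)
open import Data.Rational.Properties
open import Data.Rational.Solver using (module +-*-Solver)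
open import Data.Sum using (_⊎_)
open import Data.Vec using (tabulate; []; _∷_)
import Data.Vec.Properties as Vec
open import Relation.Binary.Construct.Closure.ReflexiveTransitive using (Star)
open import Relation.Binary.PropositionalEquality using (_≡_; _≗_; refl; cong; subst)
open import Relation.Nullary using (¬_; does)

-- Real numbers: Cauchy sequences of rationals with a modulus of
-- convergence, compared by _≈_ rather than by propositional equality.

record ℝ : Set where
  field
    seq    : ℕ → ℚ
    cauchy : ∀ ε → 0ℚ < ε → ∃ λ N → ∀ i j → N ℕ.≤ i → N ℕ.≤ j → ∣ seq i - seq j ∣ ≤ ε

open ℝ public

infix 4 _≤ᴿ_ _≈_
infixl 6 _+ᴿ_
infixl 7 _·_

_≤ᴿ_ : ℝ → ℝ → Set
x ≤ᴿ y = ∀ ε → 0ℚ < ε → ∃ λ N → ∀ i → N ℕ.≤ i → seq x i ≤ seq y i + ε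

_≈_ : ℝ → ℝ → Set
x ≈ y = x ≤ᴿ y × y ≤ᴿ x

fromℚ : ℚ → ℝ
fromℚ q .seq _ = q
fromℚ q .cauchy ε ε>0 = 0 , λ _ _ _ _ → ≤-trans (≤-reflexive (cong ∣_∣ (+-inverseʳ q))) (<⇒≤ ε>0)

_+ᴿ_ : ℝ → ℝ → ℝ
(x +ᴿ y) .seq i = seq x i + seq y i
(x +ᴿ y) .cauchy ε ε>0 = M ℕ.⊔ N , λ i j i≥ j≥ → begin
    ∣ (seq x i + seq y i) - (seq x j + seq y j) ∣
      ≡⟨ cong ∣_∣ (regroup (seq x i) (seq y i) (seq x j) (seq y j)) ⟩
    ∣ (seq x i - seq x j) + (seq y i - seq y j) ∣
      ≤⟨ ∣p+q∣≤∣p∣+∣q∣ (seq x i - seq x j) (seq y i - seq y j) ⟩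
    ∣ seq x i - seq x j ∣ + ∣ seq y i - seq y j ∣
      ≤⟨ +-mono-≤
           (proj₂ cx i j (ℕ.≤-trans (ℕ.m≤m⊔n M N) i≥) (ℕ.≤-trans (ℕ.m≤m⊔n M N) j≥))
           (proj₂ cy i j (ℕ.≤-trans (ℕ.m≤n⊔m M N) i≥) (ℕ.≤-trans (ℕ.m≤n⊔m M N) j≥)) ⟩
    ½ * ε + ½ * ε
      ≡⟨ *-distribʳ-+ ε ½ ½ ⟨
    1ℚ * ε
      ≡⟨ *-identityˡ ε ⟩
    ε ∎
  where
  open ≤-Reasoning
  regroup : ∀ a b c d → (a + b) - (c + d) ≡ (a - c) + (b - d)
  regroup = solve 4 (λ a b c d → (a :+ b) :- (c :+ d) := (a :- c) :+ (b :- d)) refl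
    where open +-*-Solver
  half>0 : 0ℚ < ½ * ε
  half>0 = positive⁻¹ (½ * ε) {{pos*pos⇒pos ½ ε {{positive ε>0}}}}
  cx = cauchy x (½ * ε) half>0
  cy = cauchy y (½ * ε) half>0
  M = proj₁ cx
  N = proj₁ cy

_·_ : ℚ → ℝ → ℝ
(q · x) .seq i = q * seq x i
(q · x) .cauchy ε ε>0 = proj₁ cx , λ i j i≥ j≥ → begin
    ∣ q * seq x i - q * seq x j ∣
      ≡⟨ cong ∣_∣ (factor q (seq x i) (seq x j)) ⟩
    ∣ q * (seq x i - seq x j) ∣
      ≡⟨ ∣p*q∣≡∣p∣*∣q∣ q (seq x i - seq x j) ⟩
    ∣ q ∣ * ∣ seq x i - seq x j ∣
      ≤⟨ *-monoˡ-≤-nonNeg ∣ q ∣ {{∣-∣-nonNeg q}} (proj₂ cx i j i≥ j≥) ⟩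
    ∣ q ∣ * δ
      ≤⟨ *-monoʳ-≤-nonNeg δ {{pos⇒nonNeg δ {{δ-pos}}}} ∣q∣≤K ⟩
    K * (1/K * ε)
      ≡⟨ *-assoc K 1/K ε ⟨
    (K * 1/K) * ε
      ≡⟨ cong (_* ε) (*-inverseʳ K {{K-nonZero}}) ⟩
    1ℚ * ε
      ≡⟨ *-identityˡ ε ⟩
    ε ∎
  where
  open ≤-Reasoning
  factor : ∀ q a b → q * a - q * b ≡ q * (a - b)
  factor = solve 3 (λ q a b → q :* a :- q :* b := q :* (a :- b)) refl
    where open +-*-Solver
  K = 1ℚ + ∣ q ∣
  K-pos : Positive K
  K-pos = pos+nonNeg⇒pos 1ℚ ∣ q ∣ {{∣-∣-nonNeg q}}
  K-nonZero = pos⇒nonZero K {{K-pos}}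
  1/K = 1/_ K {{K-nonZero}}
  δ = 1/K * ε
  δ-pos : Positive δ
  δ-pos = pos*pos⇒pos 1/K {{1/pos⇒pos K {{K-pos}}}} ε {{positive ε>0}}
  ∣q∣≤K : ∣ q ∣ ≤ K
  ∣q∣≤K = subst (_≤ K) (+-identityˡ ∣ q ∣) (+-monoˡ-≤ ∣ q ∣ (nonNegative⁻¹ 1ℚ))
  cx = cauchy x δ (positive⁻¹ δ {{δ-pos}})

-- Events are given by their indicator functions.  Only finite unions and
-- finite additivity are required, so this includes every σ-additive
-- probability space.

record ProbabilitySpace : Set₁ where
  field
    Ω          : Set
    Measurable : (Ω → Bool) → Set
    m-cong     : ∀ {E F} → E ≗ F → Measurable E → Measurable F
    m-full     : Measurable (λ _ → true)
    m-compl    : ∀ {E} → Measurable E → Measurable (λ ω → not (E ω))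
    m-union    : ∀ {E F} → Measurable E → Measurable F → Measurable (λ ω → E ω ∨ F ω)
    ℙ          : (E : Ω → Bool) → Measurable E → ℝ
    ℙ-cong     : ∀ {E F} (mE : Measurable E) (mF : Measurable F) → E ≗ F → ℙ E mE ≈ ℙ F mF
    ℙ-nonNeg   : ∀ {E} (mE : Measurable E) → fromℚ 0ℚ ≤ᴿ ℙ E mE
    ℙ-full     : ℙ (λ _ → true) m-full ≈ fromℚ 1ℚ
    ℙ-additive : ∀ {E F} (mE : Measurable E) (mF : Measurable F) →
                 (∀ ω → E ω ∧ F ω ≡ false) →
                 ℙ (λ ω → E ω ∨ F ω) (m-union mE mF) ≈ ℙ E mE +ᴿ ℙ F mF

-- Finite simple undirected graphs on the vertex set Fin n, with indexed
-- edges.  The order of the two components of `ends e` carries no meaning.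

record Graph (n : ℕ) : Set where
  field
    size : ℕ
    ends : Fin size → Fin n × Fin n

  Joins : Fin size → Fin n → Fin n → Set
  Joins e u v = ends e ≡ (u , v) ⊎ ends e ≡ (v , u)

  field
    loopless   : ∀ e v → ¬ Joins e v v
    noParallel : ∀ e f u v → Joins e u v → Joins f u v → e ≡ f

  EdgeSet : Set
  EdgeSet = Subset size

  Adjacent : EdgeSet → Fin n → Fin n → Set
  Adjacent H u v = ∃ λ e → e ∈ H × Joins e u v

  Connected : EdgeSet → Fin n → Fin n → Set
  Connected H = Star (Adjacent H)

  incident : Fin n → EdgeSet
  incident v = tabulate λ e →
    does (proj₁ (ends e) Fin.≟ v) ∨ does (proj₂ (ends e) Fin.≟ v)

  degree : EdgeSet → Fin n → ℕ
  degree H v = card (H ∩ incident v)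

record Instance (n : ℕ) : Set where
  field
    graph         : Graph n
    root          : Fin n
    bound         : Fin n → ℕ
    bound-nonZero : ∀ v → NonZero (bound v)

  open Graph graph public

  load : EdgeSet → Fin n → ℚ
  load H v = _/_ (+ degree H v) (bound v) {{bound-nonZero v}}

  maxLoad : EdgeSet → ℚ
  maxLoad H = foldr _⊔_ 0ℚ (map (load H) (allFin n))

  Solves : EdgeSet → List (Fin n) → Set
  Solves H ts = All (Connected H root) ts

  IsOPT : List (Fin n) → ℚ → Set
  IsOPT ts opt = (∃ λ H → Solves H ts × maxLoad H ≡ opt)
               × (∀ H → Solves H ts → opt ≤ maxLoad H)

-- Terminal sequences are listed newest first: in t ∷ ts the terminal t
-- arrives after those in ts.  Since `correct` quantifies over all
-- sequences, it constrains the state after every arrival.  Nothing is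
-- demanded when some terminal cannot be reached from the root in the
-- whole graph.

Purchases : ∀ {n} → Instance n → Set
Purchases {n} I = (past : List (Fin n)) (t : Fin n) → Instance.EdgeSet I

bought : ∀ {n} (I : Instance n) → Purchases I → List (Fin n) → Instance.EdgeSet I
bought I buy []       = ⊥
bought I buy (t ∷ ts) = bought I buy ts ∪ buy ts t

record OnlineAlgorithm (n : ℕ) : Set where
  open Instance
  field
    buy     : (I : Instance n) → Purchases I
    correct : ∀ I ts → Solves I ⊤ ts → Solves I (bought I (buy I) ts) ts

  output : (I : Instance n) → List (Fin n) → EdgeSet I
  output I = bought I (buy I)

sumSubsets : ∀ m → (Subset m → ℝ) → ℝ
sumSubsets zero    f = f []
sumSubsets (suc m) f =
  sumSubsets m (λ H → f (outside ∷ H)) +ᴿ sumSubsets m (λ H → f (inside ∷ H))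

_==_ : ∀ {m} → Subset m → Subset m → Bool
H == K = does (Vec.≡-dec Bool._≟_ H K)

-- A randomized algorithm is a random deterministic algorithm.  The output
-- takes finitely many values, so measurability of the events
-- {output = H} makes it a random variable.

record RandomizedAlgorithm (n : ℕ) : Set₁ where
  open Instance
  open OnlineAlgorithm
  field
    space : ProbabilitySpace

  open ProbabilitySpace space public

  field
    algorithm  : Ω → OnlineAlgorithm n
    measurable : ∀ I ts (H : EdgeSet I) →
                 Measurable (λ ω → output (algorithm ω) I ts == H)

  expectedMaxLoad : Instance n → List (Fin n) → ℝ
  expectedMaxLoad I ts = sumSubsets (size I) λ H →
    maxLoad I H · ℙ (λ ω → output (algorithm ω) I ts == H) (measurable I ts H)

{-# OPTIONS --safe #-}
module Submission where

-- The machines form a path that starts at the root, and every pair of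
-- machines has a job, a vertex adjacent to exactly these two.  Whenever the
-- job of a pair is requested, one of its two edges must be bought, so one of
-- them is bought with probability at least 1/2.  The adversary plays a
-- knockout tournament on 2 ^ k machines: it requests the job of two
-- machines and lets the one whose edge is bought with the larger
-- probability advance (up to an approximation, whence 1/4).  The champion
-- collects k edges, each bought with probability at least 1/4, and so has
-- expected degree at least k / 4, while log n is about 2 k.  Offline, every
-- job is served by the loser of its pair; each machine loses at most once,
-- so the path and these edges have degree at most 3.  Two pendant
-- terminals at the root make the optimum exactly 3.

open import Defs
open import Data.Bool using (Bool; true; false; not; _∧_; _∨_; if_then_else_)
import Data.Bool.Properties as Bool
open import Data.Empty using (⊥)
open import Data.Fin using (Fin; zero; suc; punchIn; punchOut; toℕ; fromℕ<; inject₁)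
open import Data.Fin.Induction using (<-weakInduction)
open import Data.Fin.Patterns using (0F; 1F; 2F)
import Data.Fin.Properties as Fin
open import Data.Fin.Subset using (Subset; inside; outside; _∈_; _∩_; ⊤) renaming (∣_∣ to card; _-_ to _∖_)
open import Data.Fin.Subset.Properties using (∈⊤; x∈p∩q⁺; x∈p∩q⁻; x∈p∧x≢y⇒x∈p-y; x∈p⇒∣p-x∣<∣p∣)
open import Data.Integer using (+_)
import Data.Integer as ℤ
import Data.Integer.Properties as ℤ
open import Data.List using (List; []; _∷_; _++_; length; foldr; map; allFin)
import Data.List.Membership.DecPropositional as Dec∈
import Data.List.Membership.Propositional as List
open import Data.List.Membership.Propositional.Properties using (∈-map⁺; ∈-allFin)
open import Data.List.Properties using (++-assoc; ++-identityʳ; length-map)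
open import Data.List.Relation.Unary.All as All using (All; []; _∷_)
import Data.List.Relation.Unary.All.Properties as All
open import Data.List.Relation.Unary.AllPairs using (AllPairs; []; _∷_)
import Data.List.Relation.Unary.AllPairs.Properties as AllPairs
open import Data.List.Relation.Unary.Any using (here; there)
open import Data.List.Relation.Unary.Unique.Propositional using (Unique)
import Data.List.Relation.Unary.Unique.Propositional.Properties as Unique
open import Data.Nat using (ℕ; zero; suc)
import Data.Nat as ℕ
open import Data.Nat.Logarithm using (⌈log₂_⌉; ⌈log₂⌉-mono-≤; ⌈log₂2^n⌉≡n)
import Data.Nat.Properties as ℕ
import Data.Nat.Solver
open import Data.Product using (∃; Σ-syntax; _×_; _,_; proj₁; proj₂)
open import Data.Product.Function.NonDependent.Propositional using (_×-↔_)
import Data.Product.Properties as Product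
open import Data.Rational using (ℚ; 0ℚ; 1ℚ; ½; _/_; _+_; _*_; _-_; -_; 1/_; ∣_∣; _≤_; _<_; _≤?_; _⊔_; positive; nonNegative; Positive; toℚᵘ)
open import Data.Rational.Properties hiding (_≟_)
open import Data.Rational.Solver using (module +-*-Solver)
open import Data.Rational.Unnormalised using (mkℚᵘ; *≡*; *≤*)
import Data.Rational.Unnormalised as ℚᵘ
import Data.Rational.Unnormalised.Properties as ℚᵘ
open import Data.Sum using (_⊎_; inj₁; inj₂)
open import Data.Sum.Function.Propositional using (_⊎-↔_)
import Data.Sum.Properties as Sum
open import Data.Unit using (tt) renaming (⊤ to Unit)
open import Data.Vec using (lookup; tabulate; []; _∷_; here; there)
import Data.Vec.Properties as Vec
open import Function using (_∘_; _∋_; _↔_; const; Inverse)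
open import Function.Properties.Inverse using (↔-refl; ↔-trans)
open import Level using (0ℓ)
open import Relation.Binary.Construct.Closure.ReflexiveTransitive using (_◅_; _◅◅_) renaming (ε to stop)
open import Relation.Binary.Definitions using (DecidableEquality)
open import Relation.Binary.PropositionalEquality using (_≡_; _≢_; _≗_; refl; sym; trans; cong; cong₂; subst)
import Relation.Binary.Reasoning.Base.Single
open import Relation.Nullary using (¬_; yes; no; does; contradiction; ¬?)
open import Relation.Nullary.Decidable using (dec-true; decidable-stable; from-yes)
open import Relation.Unary using (Decidable; Pred)

-- Rational arithmetic.

fromℕ : ℕ → ℚ
fromℕ d = + d / 1

toℚᵘ-fromℕ : ∀ d → toℚᵘ (fromℕ d) ℚᵘ.≃ mkℚᵘ (+ d) 0
toℚᵘ-fromℕ d = toℚᵘ-fromℚᵘ (mkℚᵘ (+ d) 0)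

fromℕ-mono : ∀ {d e} → d ℕ.≤ e → fromℕ d ≤ fromℕ e
fromℕ-mono {d} {e} d≤e = toℚᵘ-cancel-≤ (begin
  toℚᵘ (fromℕ d) ≃⟨ toℚᵘ-fromℕ d ⟩
  mkℚᵘ (+ d) 0   ≤⟨ *≤* (ℤ.*-monoʳ-≤-nonNeg (+ 1) (ℤ.+≤+ d≤e)) ⟩
  mkℚᵘ (+ e) 0   ≃⟨ toℚᵘ-fromℕ e ⟨
  toℚᵘ (fromℕ e) ∎)
  where open ℚᵘ.≤-Reasoning

fromℕ-+ : ∀ d e → fromℕ (d ℕ.+ e) ≡ fromℕ d + fromℕ e
fromℕ-+ d e = toℚᵘ-injective (begin-equality
  toℚᵘ (fromℕ (d ℕ.+ e))           ≃⟨ toℚᵘ-fromℕ (d ℕ.+ e) ⟩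
  mkℚᵘ (+ (d ℕ.+ e)) 0             ≃⟨ *≡* (cong (ℤ._* + 1) (cong₂ ℤ._+_ (sym (ℤ.*-identityʳ (+ d))) (sym (ℤ.*-identityʳ (+ e))))) ⟩
  mkℚᵘ (+ d) 0 ℚᵘ.+ mkℚᵘ (+ e) 0   ≃⟨ ℚᵘ.+-cong (toℚᵘ-fromℕ d) (toℚᵘ-fromℕ e) ⟨
  toℚᵘ (fromℕ d) ℚᵘ.+ toℚᵘ (fromℕ e) ≃⟨ toℚᵘ-homo-+ (fromℕ d) (fromℕ e) ⟨
  toℚᵘ (fromℕ d + fromℕ e)         ∎)
  where open ℚᵘ.≤-Reasoning

q+[p-q]≡p : ∀ p q → q + (p - q) ≡ p
q+[p-q]≡p = solve 2 (λ p q → q :+ (p :- q) := p) refl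
  where open +-*-Solver

p-q≤r⇒p≤q+r : ∀ p q {r} → p - q ≤ r → p ≤ q + r
p-q≤r⇒p≤q+r p q {r} p-q≤r = subst (_≤ q + r) (q+[p-q]≡p p q) (+-monoʳ-≤ q p-q≤r)

0<½*ε : ∀ {ε} → 0ℚ < ε → 0ℚ < ½ * ε
0<½*ε {ε} ε>0 = positive⁻¹ (½ * ε) {{pos*pos⇒pos ½ ε {{positive ε>0}}}}

½*ε+½*ε≡ε : ∀ ε → ½ * ε + ½ * ε ≡ ε
½*ε+½*ε≡ε ε = trans (sym (*-distribʳ-+ ε ½ ½)) (*-identityˡ ε)

p≤∣p∣ : ∀ p → p ≤ ∣ p ∣
p≤∣p∣ p with ≤-total 0ℚ p
... | inj₁ 0≤p = ≤-reflexive (sym (0≤p⇒∣p∣≡p 0≤p))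
... | inj₂ p≤0 = ≤-trans p≤0 (0≤∣p∣ p)

p≤q+p : ∀ {p q} → 0ℚ ≤ q → p ≤ q + p
p≤q+p {p} {q} 0≤q = subst (_≤ q + p) (+-identityˡ p) (+-monoˡ-≤ p 0≤q)

p≤q⇒0≤q-p : ∀ {p q} → p ≤ q → 0ℚ ≤ q - p
p≤q⇒0≤q-p {p} {q} p≤q = subst (_≤ q - p) (+-inverseʳ p) (+-monoˡ-≤ (- p) p≤q)

+-interchange : ∀ a b c d → (a + b) + (c + d) ≡ (a + c) + (b + d)
+-interchange = solve 4 (λ a b c d → (a :+ b) :+ (c :+ d) := (a :+ c) :+ (b :+ d)) refl
  where open +-*-Solver

-- Rational sequences compared up to every positive tolerance.

Seq : Set
Seq = ℕ → ℚ

infix 4 _≼_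
infixl 6 _⊕_
infixl 7 _⊙_

-- The order _≤ᴿ_ on underlying sequences, as a data type so that x and y
-- can be inferred from a proof.
record _≼_ (x y : Seq) : Set where
  constructor mk≼
  field
    eventually : ∀ ε → 0ℚ < ε → ∃ λ N → ∀ i → N ℕ.≤ i → x i ≤ y i + ε

open _≼_

≤⇒≼ : ∀ {x y} → (∀ i → x i ≤ y i) → x ≼ y
≤⇒≼ {x} {y} x≤y .eventually ε ε>0 = 0 , λ i _ →
  subst (_≤ y i + ε) (+-identityʳ (x i)) (+-mono-≤ (x≤y i) (<⇒≤ ε>0))

≗⇒≼ : ∀ {x y} → x ≗ y → x ≼ y
≗⇒≼ x≗y = ≤⇒≼ λ i → ≤-reflexive (x≗y i)

≼-refl : ∀ {x} → x ≼ x
≼-refl = ≗⇒≼ λ _ → refl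

≼-trans : ∀ {x y z} → x ≼ y → y ≼ z → x ≼ z
≼-trans {x} {y} {z} x≼y y≼z .eventually ε ε>0
  with eventually x≼y (½ * ε) (0<½*ε ε>0) | eventually y≼z (½ * ε) (0<½*ε ε>0)
... | M , p | N , q = M ℕ.⊔ N , λ i i≥ → begin
  x i                     ≤⟨ p i (ℕ.≤-trans (ℕ.m≤m⊔n M N) i≥) ⟩
  y i + ½ * ε             ≤⟨ +-monoˡ-≤ (½ * ε) (q i (ℕ.≤-trans (ℕ.m≤n⊔m M N) i≥)) ⟩
  z i + ½ * ε + ½ * ε     ≡⟨ +-assoc (z i) (½ * ε) (½ * ε) ⟩
  z i + (½ * ε + ½ * ε)   ≡⟨ cong (_+_ (z i)) (½*ε+½*ε≡ε ε) ⟩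
  z i + ε                 ∎
  where open ≤-Reasoning

module ≼-Reasoning = Relation.Binary.Reasoning.Base.Single _≼_ ≼-refl ≼-trans

*-nonNeg : ∀ {q x} → 0ℚ ≤ q → const 0ℚ ≼ x → const 0ℚ ≼ λ i → q * x i
*-nonNeg {q} {x} 0≤q 0≼x .eventually ε ε>0 = proj₁ bound , λ i i≥ → begin
  0ℚ                ≡⟨ *-zeroʳ q ⟨
  q * 0ℚ            ≤⟨ *-monoˡ-≤-nonNeg q {{nonNegative 0≤q}} (proj₂ bound i i≥) ⟩
  q * (x i + δ)     ≡⟨ *-distribˡ-+ q (x i) δ ⟩
  q * x i + q * δ   ≤⟨ +-monoʳ-≤ (q * x i) qδ≤ε ⟩
  q * x i + ε       ∎
  where
  open ≤-Reasoning
  -- The tolerance is divided by `1ℚ + q`, not by `q`, so that q may vanish.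
  K = 1ℚ + q
  K-pos : Positive K
  K-pos = pos+nonNeg⇒pos 1ℚ q {{nonNegative 0≤q}}
  K-nonZero = pos⇒nonZero K {{K-pos}}
  1/K = 1/_ K {{K-nonZero}}
  δ = 1/K * ε
  δ-pos : Positive δ
  δ-pos = pos*pos⇒pos 1/K {{1/pos⇒pos K {{K-pos}}}} ε {{positive ε>0}}
  bound = eventually 0≼x δ (positive⁻¹ δ {{δ-pos}})
  qδ≤ε : q * δ ≤ ε
  qδ≤ε = begin
    q * δ          ≤⟨ *-monoʳ-≤-nonNeg δ {{pos⇒nonNeg δ {{δ-pos}}}} (p≤q+p {q} {1ℚ} (nonNegative⁻¹ 1ℚ)) ⟩
    K * (1/K * ε)  ≡⟨ *-assoc K 1/K ε ⟨
    (K * 1/K) * ε  ≡⟨ cong (_* ε) (*-inverseʳ K {{K-nonZero}}) ⟩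
    1ℚ * ε         ≡⟨ *-identityˡ ε ⟩
    ε              ∎

-- Abstract, so that the operands can be inferred.
abstract
  _⊕_ : Seq → Seq → Seq
  (x ⊕ y) i = x i + y i

  _⊙_ : ℚ → Seq → Seq
  (q ⊙ x) i = q * x i

  -- Outside the abstract block, sums are unfolded only by rewriting along this equation; `⊙-def`
  -- does the same for scalar multiples.
  ⊕-def : ∀ {x y} → x ⊕ y ≡ λ i → x i + y i
  ⊕-def = refl

  ⊙-def : ∀ {q x} → q ⊙ x ≡ λ i → q * x i
  ⊙-def = refl

  ⊕-mono : ∀ {x y u v} → x ≼ y → u ≼ v → x ⊕ u ≼ y ⊕ v
  ⊕-mono {x} {y} {u} {v} x≼y u≼v .eventually ε ε>0
    with eventually x≼y (½ * ε) (0<½*ε ε>0) | eventually u≼v (½ * ε) (0<½*ε ε>0)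
  ... | M , p | N , q = M ℕ.⊔ N , λ i i≥ → begin
    x i + u i
      ≤⟨ +-mono-≤ (p i (ℕ.≤-trans (ℕ.m≤m⊔n M N) i≥)) (q i (ℕ.≤-trans (ℕ.m≤n⊔m M N) i≥)) ⟩
    (y i + ½ * ε) + (v i + ½ * ε)
      ≡⟨ +-interchange (y i) (½ * ε) (v i) (½ * ε) ⟩
    (y i + v i) + (½ * ε + ½ * ε)
      ≡⟨ cong (_+_ (y i + v i)) (½*ε+½*ε≡ε ε) ⟩
    (y i + v i) + ε ∎
    where open ≤-Reasoning

  ⊕-identityʳ : ∀ x → x ⊕ const 0ℚ ≗ x
  ⊕-identityʳ x i = +-identityʳ (x i)

  ⊕-interchange : ∀ x y u v → (x ⊕ y) ⊕ (u ⊕ v) ≗ (x ⊕ u) ⊕ (y ⊕ v)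
  ⊕-interchange x y u v i = +-interchange (x i) (y i) (u i) (v i)

  ⊕-cong : ∀ {x y u v} → x ≗ y → u ≗ v → x ⊕ u ≗ y ⊕ v
  ⊕-cong x≗y u≗v i = cong₂ _+_ (x≗y i) (u≗v i)

  ⊙-distribʳ-+ : ∀ x p q → (p + q) ⊙ x ≗ p ⊙ x ⊕ q ⊙ x
  ⊙-distribʳ-+ x p q i = *-distribʳ-+ (x i) p q

  1⊙ : ∀ x → 1ℚ ⊙ x ≗ x
  1⊙ x i = *-identityˡ (x i)

  0⊙ : ∀ x → 0ℚ ⊙ x ≗ const 0ℚ
  0⊙ x i = *-zeroˡ (x i)

  -- Subtract x on both sides. This yields the probability of the empty event, which is the disjoint
  -- union of itself with itself.
  x⊕x≼x⇒x≼0 : ∀ {x} → x ⊕ x ≼ x → x ≼ const 0ℚ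
  x⊕x≼x⇒x≼0 {x} x⊕x≼x .eventually ε ε>0 with eventually x⊕x≼x ε ε>0
  ... | N , p = N , λ i i≥ → begin
    x i                 ≡⟨ cancel (x i) ⟩
    - x i + (x i + x i) ≤⟨ +-monoʳ-≤ (- x i) (p i i≥) ⟩
    - x i + (x i + ε)   ≡⟨ regroup (x i) ε ⟩
    0ℚ + ε              ∎
    where
    open ≤-Reasoning
    cancel : ∀ a → a ≡ - a + (a + a)
    cancel = solve 1 (λ a → a := :- a :+ (a :+ a)) refl
      where open +-*-Solver
    regroup : ∀ a b → - a + (a + b) ≡ 0ℚ + b
    regroup = solve 2 (λ a b → :- a :+ (a :+ b) := con 0ℚ :+ b) refl
      where open +-*-Solver

  ⊙-nonNeg : ∀ {q x} → 0ℚ ≤ q → const 0ℚ ≼ x → const 0ℚ ≼ q ⊙ x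
  ⊙-nonNeg = *-nonNeg

x≼x⊕y : ∀ {x y} → const 0ℚ ≼ y → x ≼ x ⊕ y
x≼x⊕y {x} {y} 0≼y = begin
  x              ∼⟨ ≗⇒≼ (sym ∘ ⊕-identityʳ x) ⟩
  x ⊕ const 0ℚ   ∼⟨ ⊕-mono ≼-refl 0≼y ⟩
  x ⊕ y          ∎
  where open ≼-Reasoning

-- Single terms of x may be negative, so a termwise comparison fails. Instead the difference
-- `(q - p) ⊙ x` is added, which is nonnegative up to every tolerance.
⊙-monoˡ : ∀ {p q x} → p ≤ q → const 0ℚ ≼ x → p ⊙ x ≼ q ⊙ x
⊙-monoˡ {p} {q} {x} p≤q 0≼x = begin
  p ⊙ x                 ∼⟨ x≼x⊕y (⊙-nonNeg (p≤q⇒0≤q-p p≤q) 0≼x) ⟩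
  p ⊙ x ⊕ (q - p) ⊙ x   ∼⟨ ≗⇒≼ (sym ∘ ⊙-distribʳ-+ x p (q - p)) ⟩
  (p + (q - p)) ⊙ x     ≡⟨ cong (_⊙ x) (q+[p-q]≡p q p) ⟩
  q ⊙ x                 ∎
  where open ≼-Reasoning

¼ ⅛ : ℚ
¼ = + 1 / 4
⅛ = + 1 / 8

-- Comparing reals is undecidable, but approximating both summands to
-- within 1/8 already exhibits one that is at least 1/4.
1≼x⊕y⇒¼≼x⊎¼≼y : ∀ (x y : ℝ) → const 1ℚ ≼ seq x ⊕ seq y → const ¼ ≼ seq x ⊎ const ¼ ≼ seq y
1≼x⊕y⇒¼≼x⊎¼≼y x y 1≼x⊕y
  with cauchy x ⅛ 0<⅛ | cauchy y ⅛ 0<⅛ | eventually (subst (const 1ℚ ≼_) ⊕-def 1≼x⊕y) ⅛ 0<⅛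
  where
  0<⅛ : 0ℚ < ⅛
  0<⅛ = positive⁻¹ ⅛
... | L , cx | M , cy | N , p = go (+ 3 / 8 ≤? seq x i)
  where
  open ≤-Reasoning
  i = L ℕ.⊔ M ℕ.⊔ N
  L≤i : L ℕ.≤ i
  L≤i = ℕ.≤-trans (ℕ.m≤m⊔n L M) (ℕ.m≤m⊔n (L ℕ.⊔ M) N)
  M≤i : M ℕ.≤ i
  M≤i = ℕ.≤-trans (ℕ.m≤n⊔m L M) (ℕ.m≤m⊔n (L ℕ.⊔ M) N)
  N≤i : N ℕ.≤ i
  N≤i = ℕ.m≤n⊔m (L ℕ.⊔ M) N
  -- Beyond the modulus K a term that reaches 3/8 can drop by at most 1/8, which leaves 1/4.
  persists : ∀ (z : ℝ) K → (∀ i j → K ℕ.≤ i → K ℕ.≤ j → ∣ seq z i - seq z j ∣ ≤ ⅛) →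
             ∀ i → K ℕ.≤ i → + 3 / 8 ≤ seq z i → const ¼ ≼ seq z
  persists z K cz i K≤i ⅜≤z .eventually ε ε>0 = K , λ j K≤j → begin
    ¼                          ≡⟨⟩
    + 3 / 8 - ⅛                ≤⟨ +-monoˡ-≤ (- ⅛) ⅜≤z ⟩
    seq z i - ⅛                
      ≤⟨ +-monoˡ-≤ (- ⅛) (p-q≤r⇒p≤q+r (seq z i) (seq z j)
           (≤-trans (p≤∣p∣ (seq z i - seq z j)) (cz i j K≤i K≤j))) ⟩
    (seq z j + ⅛) - ⅛          ≡⟨ regroup (seq z j) ⅛ ⟩
    seq z j + 0ℚ               ≤⟨ +-monoʳ-≤ (seq z j) (<⇒≤ ε>0) ⟩
    seq z j + ε                ∎
    where
    regroup : ∀ a b → (a + b) - b ≡ a + 0ℚ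
    regroup = solve 2 (λ a b → (a :+ b) :- b := a :+ con 0ℚ) refl
      where open +-*-Solver
  go : _ → const ¼ ≼ seq x ⊎ const ¼ ≼ seq y
  go (yes ⅜≤x) = inj₁ (persists x L cx i L≤i ⅜≤x)
  -- The two terms at i sum to at least 7/8, so with the first below 3/8 the second is at least 1/2.
  go (no  ⅜≰x) = inj₂ (persists y M cy i M≤i (begin
    + 3 / 8                                          ≤⟨ from-yes (+ 3 / 8 ≤? 1ℚ - (+ 3 / 8) - ⅛) ⟩
    1ℚ - (+ 3 / 8) - ⅛                               ≤⟨ +-monoˡ-≤ (- ⅛) (+-mono-≤ (p i N≤i) (neg-antimono-≤ (<⇒≤ (≰⇒> ⅜≰x)))) ⟩
    (seq x i + seq y i + ⅛) - seq x i - ⅛            ≡⟨ regroup (seq x i) (seq y i) ⅛ ⟩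
    seq y i                                          ∎))
    where
    regroup : ∀ a b c → (a + b + c) - a - c ≡ b
    regroup = solve 3 (λ a b c → (a :+ b :+ c) :- a :- c := b) refl
      where open +-*-Solver

-- Sums and unions over all subsets of a finite set.

∑ : ∀ m → (Subset m → Seq) → Seq
∑ zero    f = f []
∑ (suc m) f = ∑ m (f ∘ (outside ∷_)) ⊕ ∑ m (f ∘ (inside ∷_))

seq-sumSubsets : ∀ m (f : Subset m → ℝ) → seq (sumSubsets m f) ≗ ∑ m (seq ∘ f)
seq-sumSubsets zero    f i = refl
seq-sumSubsets (suc m) f i = trans
  (cong₂ _+_ (seq-sumSubsets m (f ∘ (outside ∷_)) i) (seq-sumSubsets m (f ∘ (inside ∷_)) i))
  (cong (λ x → x i) (sym ⊕-def))

∑-mono : ∀ m {f g : Subset m → Seq} → (∀ H → f H ≼ g H) → ∑ m f ≼ ∑ m g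
∑-mono zero    f≼g = f≼g []
∑-mono (suc m) f≼g = ⊕-mono (∑-mono m (f≼g ∘ (outside ∷_))) (∑-mono m (f≼g ∘ (inside ∷_)))

∑-⊕ : ∀ m (f g : Subset m → Seq) → ∑ m f ⊕ ∑ m g ≗ ∑ m λ H → f H ⊕ g H
∑-⊕ zero    f g i = refl
∑-⊕ (suc m) f g i = trans
  (⊕-interchange (∑ m (f ∘ (outside ∷_))) (∑ m (f ∘ (inside ∷_))) (∑ m (g ∘ (outside ∷_))) (∑ m (g ∘ (inside ∷_))) i)
  (⊕-cong (∑-⊕ m (f ∘ (outside ∷_)) (g ∘ (outside ∷_))) (∑-⊕ m (f ∘ (inside ∷_)) (g ∘ (inside ∷_))) i)

∑-nonNeg : ∀ m {f : Subset m → Seq} → (∀ H → const 0ℚ ≼ f H) → const 0ℚ ≼ ∑ m f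
∑-nonNeg zero    0≼f = 0≼f []
∑-nonNeg (suc m) 0≼f = ≼-trans (∑-nonNeg m (0≼f ∘ (outside ∷_))) (x≼x⊕y (∑-nonNeg m (0≼f ∘ (inside ∷_))))

-- Follows the same recursion as `∑`, so that the union bound can be proved along it.
unionSubsets : ∀ {Ω : Set} m → (Subset m → Ω → Bool) → Ω → Bool
unionSubsets zero    E = E []
unionSubsets (suc m) E ω = unionSubsets m (E ∘ (outside ∷_)) ω ∨ unionSubsets m (E ∘ (inside ∷_)) ω

unionSubsets⁺ : ∀ {Ω : Set} m (E : Subset m → Ω → Bool) {ω} H → E H ω ≡ true → unionSubsets m E ω ≡ true
unionSubsets⁺ zero    E [] EH = EH
unionSubsets⁺ (suc m) E (outside ∷ H) EH rewrite unionSubsets⁺ m (E ∘ (outside ∷_)) H EH = refl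
unionSubsets⁺ (suc m) E {ω} (inside ∷ H) EH
  rewrite unionSubsets⁺ m (E ∘ (inside ∷_)) H EH = Bool.∨-zeroʳ (unionSubsets m (E ∘ (outside ∷_)) ω)

unionSubsets⁻ : ∀ {Ω : Set} m (E : Subset m → Ω → Bool) {ω} → unionSubsets m E ω ≡ true → ∃ λ H → E H ω ≡ true
unionSubsets⁻ zero    E EH = [] , EH
unionSubsets⁻ (suc m) E {ω} EH with unionSubsets m (E ∘ (outside ∷_)) ω in eq
... | true  = let H , p = unionSubsets⁻ m (E ∘ (outside ∷_)) eq in outside ∷ H , p
... | false = let H , p = unionSubsets⁻ m (E ∘ (inside ∷_)) EH in inside ∷ H , p

⇔⇒≡ : ∀ {a b} → (a ≡ true → b ≡ true) → (b ≡ true → a ≡ true) → a ≡ b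
⇔⇒≡ {true}          p q = sym (p refl)
⇔⇒≡ {false} {true}  p q = q refl
⇔⇒≡ {false} {false} p q = refl

indicator : Bool → ℚ
indicator b = if b then 1ℚ else 0ℚ

-- Finitely additive probability.

module Probability (P : ProbabilitySpace) where
  open ProbabilitySpace P

  Pr : ∀ {E} → Measurable E → Seq
  Pr mE = seq (ℙ _ mE)

  private
    disjoint : ∀ a b → a ∧ not (a ∨ not b) ≡ false
    disjoint true  b = refl
    disjoint false b = refl

    Pr-cong : ∀ {E F} (mE : Measurable E) (mF : Measurable F) → E ≗ F → Pr mE ≼ Pr mF
    Pr-cong mE mF E≗F = mk≼ (proj₁ (ℙ-cong mE mF E≗F))

    Pr-additive : ∀ {E F} (mE : Measurable E) (mF : Measurable F) → (∀ ω → E ω ∧ F ω ≡ false) →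
                  Pr (m-union mE mF) ≼ Pr mE ⊕ Pr mF × Pr mE ⊕ Pr mF ≼ Pr (m-union mE mF)
    Pr-additive mE mF E∩F≡∅ with ℙ-additive mE mF E∩F≡∅
    ... | ≤ , ≥ = subst (Pr (m-union mE mF) ≼_) (sym ⊕-def) (mk≼ ≤)
                , subst (_≼ Pr (m-union mE mF)) (sym ⊕-def) (mk≼ ≥)

  Pr-nonNeg : ∀ {E} (mE : Measurable E) → const 0ℚ ≼ Pr mE
  Pr-nonNeg mE = mk≼ (ℙ-nonNeg mE)

  m-none : Measurable (λ _ → false)
  m-none = m-compl m-full

  -- The event F minus E, written with the union and complement that a probability space offers.
  m-minus : ∀ {E F} → Measurable E → Measurable F → Measurable (λ ω → not (E ω ∨ not (F ω)))
  m-minus mE mF = m-compl (m-union mE (m-compl mF))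

  -- F is the disjoint union of E and F minus E, and the second part has nonnegative probability.
  Pr-mono : ∀ {E F} (mE : Measurable E) (mF : Measurable F) → (∀ ω → E ω ≡ true → F ω ≡ true) → Pr mE ≼ Pr mF
  Pr-mono {E} {F} mE mF E⊆F = begin
    Pr mE                ∼⟨ x≼x⊕y (Pr-nonNeg mD) ⟩
    Pr mE ⊕ Pr mD        ∼⟨ proj₂ (Pr-additive mE mD λ ω → disjoint (E ω) (F ω)) ⟩
    Pr (m-union mE mD)   ∼⟨ Pr-cong (m-union mE mD) mF (λ ω → cover (E ω) (F ω) (E⊆F ω)) ⟩
    Pr mF                ∎
    where
    open ≼-Reasoning
    mD = m-minus mE mF
    cover : ∀ a b → (a ≡ true → b ≡ true) → a ∨ not (a ∨ not b) ≡ b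
    cover true  b a⇒b = sym (a⇒b refl)
    cover false b _   = Bool.not-involutive b

  -- The union is covered by E and the disjoint event F minus E, which lies within F.
  Pr-subadditive : ∀ {E F} (mE : Measurable E) (mF : Measurable F) → Pr (m-union mE mF) ≼ Pr mE ⊕ Pr mF
  Pr-subadditive {E} {F} mE mF = begin
    Pr (m-union mE mF)   ∼⟨ Pr-mono (m-union mE mF) (m-union mE mD) (λ ω → cover (E ω) (F ω)) ⟩
    Pr (m-union mE mD)   ∼⟨ proj₁ (Pr-additive mE mD λ ω → disjoint (E ω) (F ω)) ⟩
    Pr mE ⊕ Pr mD        ∼⟨ ⊕-mono ≼-refl (Pr-mono mD mF λ ω → within (E ω) (F ω)) ⟩
    Pr mE ⊕ Pr mF        ∎
    where
    open ≼-Reasoning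
    mD = m-minus mE mF
    cover : ∀ a b → a ∨ b ≡ true → a ∨ not (a ∨ not b) ≡ true
    cover true  b    _ = refl
    cover false true _ = refl
    within : ∀ a b → not (a ∨ not b) ≡ true → b ≡ true
    within false true _ = refl

  Pr-none : Pr m-none ≼ const 0ℚ
  Pr-none = x⊕x≼x⇒x≼0 (≼-trans
    (proj₂ (Pr-additive m-none m-none λ _ → refl))
    (Pr-cong (m-union m-none m-none) m-none λ _ → refl))

  m-unionSubsets : ∀ m {E : Subset m → Ω → Bool} → (∀ H → Measurable (E H)) → Measurable (unionSubsets m E)
  m-unionSubsets zero    mE = mE []
  m-unionSubsets (suc m) mE =
    m-union (m-unionSubsets m (mE ∘ (outside ∷_))) (m-unionSubsets m (mE ∘ (inside ∷_)))

  Pr-unionSubsets : ∀ m {E : Subset m → Ω → Bool} (mE : ∀ H → Measurable (E H)) →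
                    Pr (m-unionSubsets m mE) ≼ ∑ m λ H → Pr (mE H)
  Pr-unionSubsets zero        mE = ≼-refl
  Pr-unionSubsets (suc m) {E} mE = begin
    Pr (m-unionSubsets (suc m) mE)
      ∼⟨ Pr-subadditive (m-unionSubsets m mO) (m-unionSubsets m mI) ⟩
    Pr (m-unionSubsets m mO) ⊕ Pr (m-unionSubsets m mI)
      ∼⟨ ⊕-mono (Pr-unionSubsets m mO) (Pr-unionSubsets m mI) ⟩
    ∑ (suc m) (λ H → Pr (mE H)) ∎
    where
    open ≼-Reasoning
    mO : ∀ H → Measurable (E (outside ∷ H))
    mO H = mE (outside ∷ H)
    mI : ∀ H → Measurable (E (inside ∷ H))
    mI H = mE (inside ∷ H)

  module _ {m} (X : Ω → Subset m) (mX : ∀ H → Measurable (λ ω → X ω == H)) (f : Subset m → Bool) where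
    private
      atom : Subset m → Ω → Bool
      atom H ω = f H ∧ (X ω == H)

      m-atom : ∀ H → Measurable (atom H)
      m-atom H with f H
      ... | true  = mX H
      ... | false = m-none

      Pr-atom : ∀ H → Pr (m-atom H) ≼ indicator (f H) ⊙ Pr (mX H)
      Pr-atom H with f H
      ... | true  = ≗⇒≼ λ i → sym (1⊙ (Pr (mX H)) i)
      ... | false = ≼-trans Pr-none (≗⇒≼ λ i → sym (0⊙ (Pr (mX H)) i))

      union≗ : ∀ ω → unionSubsets m atom ω ≡ f (X ω)
      union≗ ω = ⇔⇒≡ to from
        where
        to : unionSubsets m atom ω ≡ true → f (X ω) ≡ true
        to p with unionSubsets⁻ m atom {ω} p
        ... | H , q with f H in eq | Vec.≡-dec Bool._≟_ (X ω) H
        ... | true | yes refl = eq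
        from : f (X ω) ≡ true → unionSubsets m atom ω ≡ true
        from p = unionSubsets⁺ m atom (X ω)
          (cong₂ _∧_ p (dec-true (Vec.≡-dec Bool._≟_ (X ω) (X ω)) refl))

    m-preimage : Measurable (λ ω → f (X ω))
    m-preimage = m-cong union≗ (m-unionSubsets m m-atom)

    -- The event is the union of those atoms X = H for which f H is true, and the union bound
    -- applies. It converts the probability that an edge is bought into an expectation over outputs.
    Pr-preimage : Pr m-preimage ≼ ∑ m λ H → indicator (f H) ⊙ Pr (mX H)
    Pr-preimage = begin
      Pr m-preimage                             ∼⟨ Pr-cong m-preimage (m-unionSubsets m m-atom) (sym ∘ union≗) ⟩
      Pr (m-unionSubsets m m-atom)              ∼⟨ Pr-unionSubsets m m-atom ⟩
      ∑ m (λ H → Pr (m-atom H))                 ∼⟨ ∑-mono m Pr-atom ⟩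
      ∑ m (λ H → indicator (f H) ⊙ Pr (mX H))   ∎
      where open ≼-Reasoning

-- Lower and upper bounds on cardinalities.

hits : ∀ {s} → List (Fin s) → Subset s → ℕ
hits []       S = 0
hits (e ∷ es) S = (if lookup S e then 1 else 0) ℕ.+ hits es S

hits-mono : ∀ {s} {S T : Subset s} {es} → All (λ e → e ∈ S → e ∈ T) es → hits es S ℕ.≤ hits es T
hits-mono []       = ℕ.z≤n
hits-mono {S = S} {T} {e ∷ es} (e∈ ∷ es∈) = ℕ.+-mono-≤ (step e∈) (hits-mono es∈)
  where
  step : (e ∈ S → e ∈ T) → (if lookup S e then 1 else 0) ℕ.≤ (if lookup T e then 1 else 0)
  step e∈S⇒e∈T with lookup S e in eq
  ... | false = ℕ.z≤n
  ... | true rewrite Vec.[]=⇒lookup (e∈S⇒e∈T (Vec.lookup⇒[]= e S eq)) = ℕ.≤-refl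

-- Deleting a hit e from S lowers the cardinality but costs no later hit, since the later entries
-- differ from e.
hits≤card : ∀ {s} {es} (S : Subset s) → Unique es → hits es S ℕ.≤ card S
hits≤card S [] = ℕ.z≤n
hits≤card {es = e ∷ es} S (e∉es ∷ uniq) with lookup S e in eq
... | false = hits≤card S uniq
... | true  = begin-strict
  hits es S        ≤⟨ hits-mono (All.map (λ e≢f f∈S → x∈p∧x≢y⇒x∈p-y f∈S (e≢f ∘ sym)) e∉es) ⟩
  hits es (S ∖ e)  ≤⟨ hits≤card (S ∖ e) uniq ⟩
  card (S ∖ e)     <⟨ x∈p⇒∣p-x∣<∣p∣ (Vec.lookup⇒[]= e S eq) ⟩
  card S           ∎
  where open ℕ.≤-Reasoning

-- Pigeonhole: the colour of the first element is punched out, and the remaining elements are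
-- coloured with one colour fewer. This is how offline degrees are bounded.
card-≤ : ∀ {s d} (S : Subset s) (c : ∀ x → x ∈ S → Fin d) →
         (∀ {x y} (p : x ∈ S) (q : y ∈ S) → c x p ≡ c y q → x ≡ y) → card S ℕ.≤ d
card-≤ []            c inj = ℕ.z≤n
card-≤ (outside ∷ S) c inj =
  card-≤ S (λ x p → c (suc x) (there p)) λ p q eq → Fin.suc-injective (inj (there p) (there q) eq)
card-≤ {d = zero}  (inside ∷ S) c inj with () ← c zero here
card-≤ {d = suc d} (inside ∷ S) c inj = ℕ.s≤s (card-≤ S c′
  λ p q eq → Fin.suc-injective (inj (there p) (there q) (Fin.punchOut-injective (c₀≢ p) (c₀≢ q) eq)))
  where
  c₀≢ : ∀ {x} (p : x ∈ S) → c zero here ≢ c (suc x) (there p)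
  c₀≢ p eq with () ← inj here (there p) eq
  c′ : ∀ x → x ∈ S → Fin d
  c′ x p = punchOut (c₀≢ p)

-- Loads and expected loads under unit degree bounds.

≤-foldr-⊔ : ∀ {x xs} → x List.∈ xs → x ≤ foldr _⊔_ 0ℚ xs
≤-foldr-⊔ {xs = y ∷ ys} (here refl) = p≤p⊔q y (foldr _⊔_ 0ℚ ys)
≤-foldr-⊔ {xs = y ∷ ys} (there x∈)  = ≤-trans (≤-foldr-⊔ x∈) (p≤q⊔p y (foldr _⊔_ 0ℚ ys))

foldr-⊔-≤ : ∀ {A : Set} (f : A → ℚ) {b} xs → 0ℚ ≤ b → (∀ x → f x ≤ b) → foldr _⊔_ 0ℚ (map f xs) ≤ b
foldr-⊔-≤ f []       0≤b f≤b = 0≤b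
foldr-⊔-≤ f (x ∷ xs) 0≤b f≤b = ⊔-lub (f≤b x) (foldr-⊔-≤ f xs 0≤b f≤b)

unitBounds : ∀ {n} → Graph n → Fin n → Instance n
unitBounds G r = record { graph = G ; root = r ; bound = λ _ → 1 ; bound-nonZero = λ _ → _ }

module _ {n} (G : Graph n) (r : Fin n) where
  private
    I = unitBounds G r
  open Instance I

  degree≤maxLoad : ∀ H v → fromℕ (degree H v) ≤ maxLoad H
  degree≤maxLoad H v = ≤-foldr-⊔ (∈-map⁺ (load H) (∈-allFin v))

  maxLoad≤ : ∀ H {d} → (∀ v → degree H v ℕ.≤ d) → maxLoad H ≤ fromℕ d
  maxLoad≤ H {d} deg≤d = foldr-⊔-≤ (load H) (allFin n) (fromℕ-mono {0} {d} ℕ.z≤n) (λ v → fromℕ-mono {degree H v} (deg≤d v))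

  hits≤degree : ∀ H v {es} → Unique es → All (_∈ incident v) es → hits es H ℕ.≤ degree H v
  hits≤degree H v uniq inc =
    ℕ.≤-trans (hits-mono (All.map (λ e∈inc e∈H → x∈p∩q⁺ (e∈H , e∈inc)) inc)) (hits≤card (H ∩ incident v) uniq)

  module _ (A : RandomizedAlgorithm n) where
    open RandomizedAlgorithm A
    open Probability space

    out : List (Fin n) → Ω → EdgeSet
    out ts ω = OnlineAlgorithm.output (algorithm ω) I ts

    m-buys : ∀ ts e → Measurable (λ ω → lookup (out ts ω) e)
    m-buys ts e = m-preimage (out ts) (measurable I ts) (λ H → lookup H e)

    buys : List (Fin n) → Fin size → ℝ
    buys ts e = ℙ _ (m-buys ts e)

    -- Purchases are never revoked.
    buys-mono : ∀ t ts e → seq (buys ts e) ≼ seq (buys (t ∷ ts) e)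
    buys-mono t ts e = Pr-mono (m-buys ts e) (m-buys (t ∷ ts) e) λ ω e∈ →
      let new = OnlineAlgorithm.buy (algorithm ω) I ts t in
      trans (Vec.lookup-zipWith _∨_ e (out ts ω) new) (cong (_∨ lookup new e) e∈)

    -- The two purchase events cover the whole space, so the union bound applies.
    buys-cover : ∀ ts e f → (∀ ω → e ∈ out ts ω ⊎ f ∈ out ts ω) → const 1ℚ ≼ seq (buys ts e) ⊕ seq (buys ts f)
    buys-cover ts e f e∨f = begin
      const 1ℚ                                ∼⟨ mk≼ (proj₂ ℙ-full) ⟩
      Pr m-full                               ∼⟨ Pr-mono m-full m-either (λ ω _ → either ω (e∨f ω)) ⟩
      Pr m-either                             ∼⟨ Pr-subadditive (m-buys ts e) (m-buys ts f) ⟩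
      Pr (m-buys ts e) ⊕ Pr (m-buys ts f)     ∎
      where
      open ≼-Reasoning
      m-either = m-union (m-buys ts e) (m-buys ts f)
      either : ∀ ω → e ∈ out ts ω ⊎ f ∈ out ts ω → lookup (out ts ω) e ∨ lookup (out ts ω) f ≡ true
      either ω (inj₁ e∈) = cong (_∨ _) (Vec.[]=⇒lookup e∈)
      either ω (inj₂ f∈) = trans (cong (_ ∨_) (Vec.[]=⇒lookup f∈)) (Bool.∨-zeroʳ _)

    private
      p : List (Fin n) → EdgeSet → Seq
      p ts H = Pr (measurable I ts H)

    -- Linearity of expectation: the number of hits is a sum of indicators, and each has expectation
    -- at least 1/4.
    expectedHits : ∀ {ts} es → All (λ e → const ¼ ≼ seq (buys ts e)) es →
      const (fromℕ (length es) * ¼) ≼ ∑ size λ H → fromℕ (hits es H) ⊙ p ts H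
    expectedHits {ts} [] [] = ∑-nonNeg size λ H → ⊙-nonNeg ≤-refl (Pr-nonNeg (measurable I ts H))
    expectedHits {ts} (e ∷ es) (¼≼e ∷ ¼≼es) = begin
      const (fromℕ (suc (length es)) * ¼)
        ∼⟨ ≗⇒≼ (λ i → trans (split-¼ (length es)) (cong (λ x → x i) (sym ⊕-def))) ⟩
      const ¼ ⊕ const (fromℕ (length es) * ¼)
        ∼⟨ ⊕-mono (≼-trans ¼≼e (Pr-preimage (out ts) (measurable I ts) (λ H → lookup H e))) (expectedHits es ¼≼es) ⟩
      ∑ size first ⊕ ∑ size rest
        ∼⟨ ≗⇒≼ (∑-⊕ size first rest) ⟩
      ∑ size (λ H → first H ⊕ rest H)
        ∼⟨ ∑-mono size (λ H → ≗⇒≼ (combine (lookup H e) (hits es H) (p ts H))) ⟩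
      ∑ size (λ H → fromℕ (hits (e ∷ es) H) ⊙ p ts H) ∎
      where
      open ≼-Reasoning
      first rest : EdgeSet → Seq
      first H = indicator (lookup H e) ⊙ p ts H
      rest  H = fromℕ (hits es H) ⊙ p ts H
      split-¼ : ∀ l → fromℕ (suc l) * ¼ ≡ ¼ + fromℕ l * ¼
      split-¼ l = trans (cong (_* ¼) (fromℕ-+ 1 l)) (*-distribʳ-+ ¼ 1ℚ (fromℕ l))
      indicator-fromℕ : ∀ b k → indicator b + fromℕ k ≡ fromℕ ((if b then 1 else 0) ℕ.+ k)
      indicator-fromℕ false k = +-identityˡ (fromℕ k)
      indicator-fromℕ true  k = sym (fromℕ-+ 1 k)
      combine : ∀ b k x → indicator b ⊙ x ⊕ fromℕ k ⊙ x ≗ fromℕ ((if b then 1 else 0) ℕ.+ k) ⊙ x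
      combine b k x i = trans (sym (⊙-distribʳ-+ x (indicator b) (fromℕ k) i))
                              (cong (λ q → (q ⊙ x) i) (indicator-fromℕ b k))

    -- For every output H, distinct edges at v that lie in H count towards the degree of v, hence
    -- towards the maximum load.
    expectedMaxLoad-≥ : ∀ ts v es → Unique es → All (_∈ incident v) es →
      All (λ e → const ¼ ≼ seq (buys ts e)) es →
      const (fromℕ (length es) * ¼) ≼ seq (expectedMaxLoad I ts)
    expectedMaxLoad-≥ ts v es uniq inc ¼≼es = begin
      const (fromℕ (length es) * ¼)                    ∼⟨ expectedHits es ¼≼es ⟩
      ∑ size (λ H → fromℕ (hits es H) ⊙ p ts H)        ∼⟨ ∑-mono size hits≼maxLoad ⟩
      ∑ size (λ H i → maxLoad H * p ts H i)            ∼⟨ ≗⇒≼ (λ i → sym (seq-sumSubsets size _ i)) ⟩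
      seq (expectedMaxLoad I ts) ∎
      where
      open ≼-Reasoning
      hits≼maxLoad : ∀ H → fromℕ (hits es H) ⊙ p ts H ≼ λ i → maxLoad H * p ts H i
      hits≼maxLoad H = subst (fromℕ (hits es H) ⊙ p ts H ≼_) ⊙-def (⊙-monoˡ
        (≤-trans (fromℕ-mono (hits≤degree H v uniq inc)) (degree≤maxLoad H v))
        (Pr-nonNeg (measurable I ts H)))

-- Graphs presented by finite types of vertices and oriented edges.

module Presentation {n s : ℕ} {V E : Set} (vtx : Fin n ↔ V) (edg : Fin s ↔ E) (src tgt : E → V)
  (src≢tgt : ∀ e → src e ≢ tgt e)
  (noParallel : ∀ e f → src e ≡ src f → tgt e ≡ tgt f → e ≡ f)
  (noAntiparallel : ∀ e f → src e ≡ tgt f → tgt e ≢ src f)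
  where

  open Inverse vtx using () renaming (from to vertex; to to label; strictlyInverseˡ to label-vertex) public
  open Inverse edg using () renaming (from to edge; to to name; strictlyInverseˡ to name-edge; strictlyInverseʳ to edge-name) public

  edge-injective : ∀ {e f} → edge e ≡ edge f → e ≡ f
  edge-injective {e} {f} eq = trans (sym (name-edge e)) (trans (cong name eq) (name-edge f))

  name-injective : ∀ {x y} → name x ≡ name y → x ≡ y
  name-injective {x} {y} eq = trans (sym (edge-name x)) (trans (cong edge eq) (edge-name y))

  private
    ends : Fin s → Fin n × Fin n
    ends x = vertex (src (name x)) , vertex (tgt (name x))

    ends⁻ : ∀ {x u v} → ends x ≡ (u , v) → src (name x) ≡ label u × tgt (name x) ≡ label v
    ends⁻ refl = sym (label-vertex _) , sym (label-vertex _)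

  graph : Graph n
  graph = record
    { size = s
    ; ends = ends
    ; loopless = λ
      { x v (inj₁ eq) → src≢tgt (name x) (trans (proj₁ (ends⁻ eq)) (sym (proj₂ (ends⁻ eq))))
      ; x v (inj₂ eq) → src≢tgt (name x) (trans (proj₁ (ends⁻ eq)) (sym (proj₂ (ends⁻ eq)))) }
    ; noParallel = λ
      { x y u v (inj₁ p) (inj₁ q) → same x y p q
      ; x y u v (inj₁ p) (inj₂ q) → opposite x y p q
      ; x y u v (inj₂ p) (inj₁ q) → opposite x y p q
      ; x y u v (inj₂ p) (inj₂ q) → same x y p q }
    }
    where
    same : ∀ x y {u v} → ends x ≡ (u , v) → ends y ≡ (u , v) → x ≡ y
    same x y p q = name-injective (noParallel (name x) (name y)
      (trans (proj₁ (ends⁻ p)) (sym (proj₁ (ends⁻ q)))) (trans (proj₂ (ends⁻ p)) (sym (proj₂ (ends⁻ q)))))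
    opposite : ∀ x y {u v} → ends x ≡ (u , v) → ends y ≡ (v , u) → x ≡ y
    opposite x y p q = contradiction
      (trans (proj₂ (ends⁻ p)) (sym (proj₁ (ends⁻ q))))
      (noAntiparallel (name x) (name y) (trans (proj₁ (ends⁻ p)) (sym (proj₂ (ends⁻ q)))))

  open Graph graph using (EdgeSet; Adjacent; Connected; incident)

  ends-edge : ∀ e → ends (edge e) ≡ (vertex (src e) , vertex (tgt e))
  ends-edge e = cong (λ f → vertex (src f) , vertex (tgt f)) (name-edge e)

  adjacent : ∀ {H : EdgeSet} e → edge e ∈ H → Adjacent H (vertex (src e)) (vertex (tgt e))
  adjacent e e∈H = edge e , e∈H , inj₁ (ends-edge e)

  adjacentᵒ : ∀ {H : EdgeSet} e → edge e ∈ H → Adjacent H (vertex (tgt e)) (vertex (src e))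
  adjacentᵒ e e∈H = edge e , e∈H , inj₂ (ends-edge e)

  incident⁺ : ∀ e v → src e ≡ v ⊎ tgt e ≡ v → edge e ∈ incident (vertex v)
  incident⁺ e v inc = Vec.lookup⇒[]= (edge e) (incident (vertex v))
    (trans (Vec.lookup∘tabulate _ (edge e))
      (subst (λ uw → does (proj₁ uw Fin.≟ vertex v) ∨ does (proj₂ uw Fin.≟ vertex v) ≡ true)
             (sym (ends-edge e)) (either inc)))
    where
    either : src e ≡ v ⊎ tgt e ≡ v →
             does (vertex (src e) Fin.≟ vertex v) ∨ does (vertex (tgt e) Fin.≟ vertex v) ≡ true
    either (inj₁ eq) = cong (_∨ does (vertex (tgt e) Fin.≟ vertex v)) (dec-true (vertex (src e) Fin.≟ vertex v) (cong vertex eq))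
    either (inj₂ eq) = trans
      (cong (does (vertex (src e) Fin.≟ vertex v) ∨_) (dec-true (vertex (tgt e) Fin.≟ vertex v) (cong vertex eq)))
      (Bool.∨-zeroʳ _)

  incident⁻ : ∀ x v → x ∈ incident v → src (name x) ≡ label v ⊎ tgt (name x) ≡ label v
  incident⁻ x v x∈ with trans (sym (Vec.lookup∘tabulate _ x)) (Vec.[]=⇒lookup x∈)
  ... | eq with vertex (src (name x)) Fin.≟ v | vertex (tgt (name x)) Fin.≟ v
  ... | yes refl | _        = inj₁ (sym (label-vertex _))
  ... | no _     | yes refl = inj₂ (sym (label-vertex _))

  selection : (E → Bool) → EdgeSet
  selection f = tabulate (f ∘ name)

  selection⁺ : ∀ f e → f e ≡ true → edge e ∈ selection f
  selection⁺ f e fe = Vec.lookup⇒[]= (edge e) _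
    (trans (Vec.lookup∘tabulate (f ∘ name) (edge e)) (trans (cong f (name-edge e)) fe))

  selection⁻ : ∀ f {x} → x ∈ selection f → f (name x) ≡ true
  selection⁻ f {x} x∈ = trans (sym (Vec.lookup∘tabulate (f ∘ name) x)) (Vec.[]=⇒lookup x∈)

  -- Cut argument: the first step of the walk that leaves P uses such an edge. With a suitable P
  -- this forces purchases.
  crossing : ∀ {P : Pred V 0ℓ} {H : EdgeSet} u v → Decidable P → Connected H (vertex u) (vertex v) → P u → ¬ P v →
             ∃ λ e → edge e ∈ H × (P (src e) × ¬ P (tgt e) ⊎ P (tgt e) × ¬ P (src e))
  crossing {P} {H} u v P? path Pu ¬Pv =
    go path (subst P (sym (label-vertex u)) Pu) (¬Pv ∘ subst P (label-vertex v))
    where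
    go : ∀ {a b} → Connected H a b → P (label a) → ¬ P (label b) →
         ∃ λ e → edge e ∈ H × (P (src e) × ¬ P (tgt e) ⊎ P (tgt e) × ¬ P (src e))
    go stop Pa ¬Pb = contradiction Pa ¬Pb
    go (_◅_ {j = c} (x , x∈H , joins) path) Pa ¬Pb with P? (label c)
    ... | yes Pc = go path Pc ¬Pb
    ... | no ¬Pc = name x , subst (_∈ H) (sym (edge-name x)) x∈H , sides joins
      where
      sides : Graph.Joins graph x _ c → _
      sides (inj₁ eq) = inj₁ (subst P (sym (proj₁ (ends⁻ eq))) Pa , ¬Pc ∘ subst P (proj₂ (ends⁻ eq)))
      sides (inj₂ eq) = inj₂ (subst P (sym (proj₂ (ends⁻ eq))) Pa , ¬Pc ∘ subst P (proj₁ (ends⁻ eq)))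

-- The knockout tournament.

-- Ordered pairs of distinct machines, the second one numbered among those other than the first. An
-- unordered pair thus has two jobs.
Job : ℕ → Set
Job m = Fin (suc m) × Fin m

-- The job (i , j) may be served by machine i or by machine punchIn i j; a
-- pair of a side and a job is one of the two edges leaving the job.
Link : ℕ → Set
Link m = Bool × Job m

machine : ∀ {m} → Link m → Fin (suc m)
machine (true  , i , j) = i
machine (false , i , j) = punchIn i j

flip : ∀ {m} → Link m → Link m
flip (b , t) = not b , t

-- The adversary sees the algorithm only through `prob L f`, read as the probability that link f has
-- been bought once the jobs of L, newest first, have been requested. By `prob-flip` the newest link
-- of the history matters only through its job.
module Tournament {m : ℕ}
  (prob : List (Link m) → Link m → ℝ)
  (prob-mono : ∀ e L f → seq (prob L f) ≼ seq (prob (e ∷ L) f))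
  (prob-flip : ∀ e L f → prob (flip e ∷ L) f ≡ prob (e ∷ L) f)
  (prob-cover : ∀ e L → const 1ℚ ≼ seq (prob (e ∷ L) e) ⊕ seq (prob (e ∷ L) (flip e)))
  where

  prob-mono-++ : ∀ K L f → seq (prob L f) ≼ seq (prob (K ++ L) f)
  prob-mono-++ []      L f = ≼-refl
  prob-mono-++ (e ∷ K) L f = ≼-trans (prob-mono-++ K L f) (prob-mono e (K ++ L) f)

  -- A subtournament among the machines satisfying R, starting after the
  -- jobs of L were issued.  Its jobs are those of losses, each recorded
  -- with the link to the machine that dropped out.
  record Outcome (R : Fin (suc m) → Set) (k : ℕ) (L : List (Link m)) : Set where
    field
      winner          : Fin (suc m)
      winner-in       : R winner
      losses          : List (Link m)
      losses-in       : All (λ e → R (machine e) × machine e ≢ winner) losses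
      losses-distinct : AllPairs (λ e f → machine e ≢ machine f) losses
      gains           : List (Link m)
      gains-length    : length gains ≡ k
      gains-unique    : Unique gains
      gains-at        : All (λ e → machine e ≡ winner × R (machine (flip e))) gains
      gains-prob      : All (λ e → const ¼ ≼ seq (prob (losses ++ L) e)) gains

  open Outcome

  -- Records a decided final: e is the link the champion gains, `flip e` the one its opponent loses,
  -- K the losses of both halves, and `Rʷ` the half of the champion.
  finish : ∀ {R Rʷ : Fin (suc m) → Set} {k L K} (e : Link m) gs →
    (∀ {x} → Rʷ x → R x) → R (machine e) → R (machine (flip e)) →
    ¬ Rʷ (machine (flip e)) → machine (flip e) ≢ machine e →
    All (λ f → R (machine f) × machine f ≢ machine e × machine f ≢ machine (flip e)) K →
    AllPairs (λ e f → machine e ≢ machine f) K →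
    length gs ≡ k → Unique gs → All (λ f → machine f ≡ machine e × Rʷ (machine (flip f))) gs →
    All (λ f → const ¼ ≼ seq (prob (K ++ L) f)) gs →
    const ¼ ≼ seq (prob (flip e ∷ K ++ L) e) →
    Outcome R (suc k) L
  finish {L = L} {K} e gs Rʷ⊆R e∈R l∈R l∉Rʷ l≢w K-in K-distinct len uniq at ¼≼gs ¼≼e = record
    { winner = machine e
    ; winner-in = e∈R
    ; losses = flip e ∷ K
    ; losses-in = (l∈R , l≢w) ∷ All.map (λ { (f∈R , f≢w , _) → f∈R , f≢w }) K-in
    ; losses-distinct = All.map (λ { (_ , _ , f≢l) → f≢l ∘ sym }) K-in ∷ K-distinct
    ; gains = e ∷ gs
    ; gains-length = cong suc len
    -- The opponents of earlier gains lie in the champion's half, the final opponent does not.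
    ; gains-unique = All.map (λ { (_ , f∈Rʷ) refl → l∉Rʷ f∈Rʷ }) at ∷ uniq
    ; gains-at = (refl , l∈R) ∷ All.map (λ { (f≡ , f∈) → f≡ , Rʷ⊆R f∈ }) at
    ; gains-prob = ¼≼e ∷ All.map (λ {f} ¼≼f → ≼-trans ¼≼f (prob-mono (flip e) (K ++ L) f)) ¼≼gs
    }

  -- The winners of two disjoint halves meet in one more job. The second half is played after the
  -- first, so gains of the first are carried over its history by monotonicity, while gains of the
  -- second only need reassociation.
  merge : ∀ {R R₁ R₂ : Fin (suc m) → Set} {k L} → (∀ {x} → R₁ x → ¬ R₂ x) →
          (∀ {x} → R₁ x → R x) → (∀ {x} → R₂ x → R x) →
          (A : Outcome R₁ k L) → Outcome R₂ k (losses A ++ L) → Outcome R (suc k) L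
  merge {R} {R₁} {R₂} {k} {L} disjoint R₁⊆R R₂⊆R A B =
    go (1≼x⊕y⇒¼≼x⊎¼≼y (prob (e ∷ K ++ L) e) (prob (e ∷ K ++ L) (flip e)) (prob-cover e (K ++ L)))
    where
    K = losses B ++ losses A
    w₁≢w₂ : winner A ≢ winner B
    w₁≢w₂ eq = disjoint (winner-in A) (subst R₂ (sym eq) (winner-in B))
    e : Link m
    e = true , winner A , punchOut w₁≢w₂
    l≡w₂ : machine (flip e) ≡ winner B
    l≡w₂ = Fin.punchIn-punchOut w₁≢w₂
    l∈R₂ : R₂ (machine (flip e))
    l∈R₂ = subst R₂ (sym l≡w₂) (winner-in B)
    w₁≢l : winner A ≢ machine (flip e)
    w₁≢l eq = disjoint (winner-in A) (subst R₂ (sym eq) l∈R₂)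
    K-in : All (λ f → R (machine f) × machine f ≢ winner A × machine f ≢ machine (flip e)) K
    K-in = All.++⁺
      (All.map (λ { {f} (f∈ , f≢) → R₂⊆R f∈ , (λ eq → disjoint (subst R₁ (sym eq) (winner-in A)) f∈)
                                           , (λ eq → f≢ (trans eq l≡w₂)) }) (losses-in B))
      (All.map (λ { {f} (f∈ , f≢) → R₁⊆R f∈ , f≢ , (λ eq → disjoint f∈ (subst R₂ (sym eq) l∈R₂)) }) (losses-in A))
    K-distinct : AllPairs (λ e f → machine e ≢ machine f) K
    K-distinct = AllPairs.++⁺ (losses-distinct B) (losses-distinct A)
      (All.map (λ { (f∈ , _) → All.map (λ { (g∈ , _) eq → disjoint g∈ (subst R₂ eq f∈) }) (losses-in A) }) (losses-in B))
    assoc : losses B ++ (losses A ++ L) ≡ K ++ L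
    assoc = sym (++-assoc (losses B) (losses A) L)
    go : const ¼ ≼ seq (prob (e ∷ K ++ L) e) ⊎ const ¼ ≼ seq (prob (e ∷ K ++ L) (flip e)) → Outcome R (suc k) L
    -- The history records the loser's link `flip e`, whereas the bound was obtained with `e`;
    -- `prob-flip` reconciles them.
    go (inj₁ ¼≼e) = finish {Rʷ = R₁} e (gains A) R₁⊆R (R₁⊆R (winner-in A)) (R₂⊆R l∈R₂)
      (λ l∈R₁ → disjoint l∈R₁ l∈R₂) (w₁≢l ∘ sym) K-in K-distinct
      (gains-length A) (gains-unique A) (gains-at A)
      (All.map (λ {f} ¼≼f → subst (λ J → const ¼ ≼ seq (prob J f)) assoc
        (≼-trans ¼≼f (prob-mono-++ (losses B) (losses A ++ L) f))) (gains-prob A))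
      (subst (λ x → const ¼ ≼ seq x) (sym (prob-flip e (K ++ L) e)) ¼≼e)
    -- The roles are swapped, and `flip (flip e)` computes to `e`.
    go (inj₂ ¼≼l) = finish {Rʷ = R₂} (flip e) (gains B) R₂⊆R (R₂⊆R l∈R₂) (R₁⊆R (winner-in A))
      (disjoint (winner-in A)) w₁≢l
      (All.map (λ { (f∈ , f≢w , f≢l) → f∈ , f≢l , f≢w }) K-in) K-distinct
      (gains-length B) (gains-unique B)
      (All.map (λ { (f≡ , f∈) → trans f≡ (sym l≡w₂) , f∈ }) (gains-at B))
      (All.map (λ {f} → subst (λ J → const ¼ ≼ seq (prob J f)) assoc) (gains-prob B))
      ¼≼l

  Range : ℕ → ℕ → Fin (suc m) → Set
  Range o k x = o ℕ.≤ toℕ x × toℕ x ℕ.< o ℕ.+ 2 ℕ.^ k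

  -- The interval is halved; the upper half starts from the history that the lower half leaves
  -- behind.
  play : ∀ k o → o ℕ.+ 2 ℕ.^ k ℕ.≤ suc m → ∀ L → Outcome (Range o k) k L
  play zero o o+1≤m L = record
    { winner = x
    ; winner-in = ℕ.≤-reflexive (sym x≡o) , ℕ.≤-reflexive (trans (cong suc x≡o) (ℕ.+-comm 1 o))
    ; losses = [] ; losses-in = [] ; losses-distinct = []
    ; gains = [] ; gains-length = refl ; gains-unique = [] ; gains-at = [] ; gains-prob = []
    }
    where
    o<m : o ℕ.< suc m
    o<m = subst (ℕ._≤ suc m) (ℕ.+-comm o 1) o+1≤m
    x = fromℕ< o<m
    x≡o : toℕ x ≡ o
    x≡o = Fin.toℕ-fromℕ< o<m
  play (suc k) o o+2^1+k≤m L = merge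
    (λ { (_ , x<) (≤x , _) → ℕ.<⇒≱ x< ≤x })
    (λ { (o≤x , x<) → o≤x , ℕ.<-≤-trans x< (ℕ.+-monoʳ-≤ o (ℕ.m≤m+n (2 ℕ.^ k) _)) })
    (λ { {x} (o+≤x , x<) → ℕ.≤-trans (ℕ.m≤m+n o _) o+≤x , subst (toℕ x ℕ.<_) double x< })
    A (play k (o ℕ.+ 2 ℕ.^ k) (subst (ℕ._≤ suc m) (sym double) o+2^1+k≤m) (losses A ++ L))
    where
    double : o ℕ.+ 2 ℕ.^ k ℕ.+ 2 ℕ.^ k ≡ o ℕ.+ 2 ℕ.^ suc k
    double = trans (ℕ.+-assoc o (2 ℕ.^ k) (2 ℕ.^ k)) (cong (λ t → o ℕ.+ (2 ℕ.^ k ℕ.+ t)) (sym (ℕ.+-identityʳ (2 ℕ.^ k))))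
    A = play k o (ℕ.≤-trans (ℕ.+-monoʳ-≤ o (ℕ.m≤m+n (2 ℕ.^ k) _)) o+2^1+k≤m) L

-- Vertices and edges of the hard graph.

-- The root is core zero and machine i is core (suc i).
Vertex Edge : ℕ → Set
Vertex m = Fin (suc (suc m)) ⊎ Bool ⊎ Job m
Edge   m = Fin (suc m) ⊎ Bool ⊎ Link m

order edgeCount : ℕ → ℕ
order m = suc (suc m) ℕ.+ (2 ℕ.+ suc m ℕ.* m)
edgeCount m = suc m ℕ.+ (2 ℕ.+ 2 ℕ.* (suc m ℕ.* m))

pattern core x    = inj₁ x
pattern pendant b = inj₂ (inj₁ b)
pattern job t     = inj₂ (inj₂ t)

pattern path i  = inj₁ i
pattern spoke b = inj₂ (inj₁ b)
pattern link e  = inj₂ (inj₂ e)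

Fin-order↔Vertex : ∀ m → Fin (order m) ↔ Vertex m
Fin-order↔Vertex m = ↔-trans Fin.+↔⊎ (↔-refl ⊎-↔ ↔-trans Fin.+↔⊎ (Fin.2↔Bool ⊎-↔ Fin.*↔×))

Fin-edgeCount↔Edge : ∀ m → Fin (edgeCount m) ↔ Edge m
Fin-edgeCount↔Edge m = ↔-trans Fin.+↔⊎ (↔-refl ⊎-↔ ↔-trans Fin.+↔⊎
  (Fin.2↔Bool ⊎-↔ ↔-trans Fin.*↔× (Fin.2↔Bool ×-↔ Fin.*↔×)))

src tgt : ∀ {m} → Edge m → Vertex m
src (path i)       = core (inject₁ i)
src (spoke b)      = core zero
src (link (b , t)) = job t
tgt (path i)       = core (suc i)
tgt (spoke b)      = pendant b
tgt (link e)       = core (suc (machine e))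

src≢tgt : ∀ {m} (e : Edge m) → src e ≢ tgt e
src≢tgt (path i) eq = ℕ.<⇒≢ (ℕ.n<1+n (toℕ i))
  (trans (sym (Fin.toℕ-inject₁ i)) (cong toℕ (Sum.inj₁-injective eq)))
src≢tgt (spoke b) ()
src≢tgt (link e)  ()

noParallel : ∀ {m} (e f : Edge m) → src e ≡ src f → tgt e ≡ tgt f → e ≡ f
noParallel (path i)  (path j)  _ refl = refl
noParallel (path i)  (spoke c) _ ()
noParallel (path i)  (link f)  () _
noParallel (spoke b) (path j)  _ ()
noParallel (spoke b) (spoke c) _ refl = refl
noParallel (spoke b) (link f)  () _
noParallel (link e)  (path j)  () _
noParallel (link e)  (spoke c) () _
noParallel (link (true  , i , j)) (link (true  , _)) refl _ = refl
noParallel (link (false , i , j)) (link (false , _)) refl _ = refl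
noParallel (link (true  , i , j)) (link (false , _)) refl eq =
  contradiction (sym (Fin.suc-injective (Sum.inj₁-injective eq))) (Fin.punchInᵢ≢i i j)
noParallel (link (false , i , j)) (link (true  , _)) refl eq =
  contradiction (Fin.suc-injective (Sum.inj₁-injective eq)) (Fin.punchInᵢ≢i i j)

noAntiparallel : ∀ {m} (e f : Edge m) → src e ≡ tgt f → tgt e ≢ src f
-- All path edges point away from the root, so such a pair would give both j < i and i < j.
noAntiparallel (path i)  (path j)  p q = ℕ.<-asym (j<i p) (j<i (sym q))
  where
  j<i : ∀ {m} {i j : Fin (suc m)} → core (inject₁ i) ≡ (Vertex m ∋ core (suc j)) → toℕ j ℕ.< toℕ i
  j<i {i = i} eq = ℕ.≤-reflexive (trans (sym (cong toℕ (Sum.inj₁-injective eq))) (Fin.toℕ-inject₁ i))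
noAntiparallel (path i)  (spoke c) ()
noAntiparallel (path i)  (link f)  _ ()
noAntiparallel (spoke b) (path j)  ()
noAntiparallel (spoke b) (spoke c) ()
noAntiparallel (spoke b) (link f)  ()
noAntiparallel (link e)  (path j)  ()
noAntiparallel (link e)  (spoke c) ()
noAntiparallel (link e)  (link f)  ()

-- Three colours for the offline edges at each vertex.

AllPairs⇒injective : ∀ {A B : Set} {f : A → B} {xs x y} → AllPairs (λ x y → f x ≢ f y) xs →
                     x List.∈ xs → y List.∈ xs → f x ≡ f y → x ≡ y
AllPairs⇒injective (_ ∷ _)   (here refl) (here refl) _  = refl
AllPairs⇒injective (x≢ ∷ _)  (here refl) (there y∈)  eq = contradiction eq (All.lookup x≢ y∈)
AllPairs⇒injective (x≢ ∷ _)  (there x∈)  (here refl) eq = contradiction (sym eq) (All.lookup x≢ x∈)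
AllPairs⇒injective (_ ∷ xs≢) (there x∈)  (there y∈)  eq = AllPairs⇒injective xs≢ x∈ y∈ eq

-- On a machine the colours stand for: path edge in, path edge out, lost
-- job.  The two spokes at the root take the two free ones.
colour : ∀ {m} → Vertex m → Edge m → Fin 3
colour (core x) (path i) with suc i Fin.≟ x
... | yes _ = 0F
... | no  _ = 1F
colour (core x) (spoke true)  = 0F
colour (core x) (spoke false) = 2F
colour (core x) (link e)      = 2F
colour (job t)  (link (true , _)) = 0F
colour (job t)  (link (false , _)) = 1F
colour _        _             = 0F

Incident : ∀ {m} → Edge m → Vertex m → Set
Incident e v = src e ≡ v ⊎ tgt e ≡ v

module _ {m} (L : List (Link m)) where
  open Dec∈ (Product.≡-dec Bool._≟_ (Product.≡-dec (Fin._≟_ {suc m}) (Fin._≟_ {m}))) using (_∈?_)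

  -- The offline solution, when L lists the links to the losers.
  Chosen : Edge m → Set
  Chosen (link e) = e List.∈ L
  Chosen _        = Unit

  chosen? : Decidable Chosen
  chosen? (path i)  = yes tt
  chosen? (spoke b) = yes tt
  chosen? (link e)  = e ∈? L

  -- Distinctness leaves at most one chosen link per machine. Only the root has spokes, and it has
  -- neither a link nor an incoming path edge, so `0F` and `2F` are free there. A job has one link
  -- per side and a pendant has a single edge.
  colour-injective : AllPairs (λ e f → machine e ≢ machine f) L →
    ∀ v e f → Chosen e → Chosen f → Incident e v → Incident f v → colour v e ≡ colour v f → e ≡ f
  colour-injective distinct = λ
    { (core x) (path i) (path j) _ _ p q → paths x i j p q
    ; (core x) (path i) (spoke b) _ _ p (inj₁ refl) eq → contradiction eq (path≢spoke i b)
    ; (core x) (spoke b) (path i) _ _ (inj₁ refl) q eq → contradiction (sym eq) (path≢spoke i b)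
    ; (core x) (path i) (link f) _ _ _ _ eq → contradiction eq (path≢link x i)
    ; (core x) (link e) (path i) _ _ _ _ eq → contradiction (sym eq) (path≢link x i)
    ; (core x) (spoke true)  (spoke true)  _ _ _ _ _ → refl
    ; (core x) (spoke false) (spoke false) _ _ _ _ _ → refl
    ; (core x) (spoke b) (link f) _ _ (inj₁ refl) (inj₁ ())
    ; (core x) (spoke b) (link f) _ _ (inj₁ refl) (inj₂ ())
    ; (core x) (link e) (spoke b) _ _ (inj₁ ()) (inj₁ refl)
    ; (core x) (link e) (spoke b) _ _ (inj₂ ()) (inj₁ refl)
    ; (core x) (link e) (link f) e∈ f∈ (inj₂ refl) (inj₂ eq) _ →
        cong (λ e → link e) (AllPairs⇒injective distinct e∈ f∈ (sym (Fin.suc-injective (Sum.inj₁-injective eq))))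
    ; (pendant b) (spoke _) (spoke _) _ _ (inj₂ refl) (inj₂ refl) _ → refl
    ; (pendant b) (path i) _ _ _ (inj₁ ())
    ; (pendant b) (path i) _ _ _ (inj₂ ())
    ; (pendant b) (link i) _ _ _ (inj₁ ())
    ; (pendant b) (link i) _ _ _ (inj₂ ())
    ; (pendant b) (spoke _) (path i) _ _ _ (inj₁ ())
    ; (pendant b) (spoke _) (path i) _ _ _ (inj₂ ())
    ; (pendant b) (spoke _) (link i) _ _ _ (inj₁ ())
    ; (pendant b) (spoke _) (link i) _ _ _ (inj₂ ())
    ; (job t) (link (true  , _)) (link (true  , _)) _ _ (inj₁ refl) (inj₁ refl) _ → refl
    ; (job t) (link (false , _)) (link (false , _)) _ _ (inj₁ refl) (inj₁ refl) _ → refl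
    ; (job t) (path i) _ _ _ (inj₁ ())
    ; (job t) (path i) _ _ _ (inj₂ ())
    ; (job t) (spoke i) _ _ _ (inj₁ ())
    ; (job t) (spoke i) _ _ _ (inj₂ ())
    ; (job t) (link _) (path i) _ _ _ (inj₁ ())
    ; (job t) (link _) (path i) _ _ _ (inj₂ ())
    ; (job t) (link _) (spoke i) _ _ _ (inj₁ ())
    ; (job t) (link _) (spoke i) _ _ _ (inj₂ ())
    }
    where
    outgoing : ∀ {x i} → Incident {m} (path i) (core x) → suc i ≢ x → inject₁ i ≡ x
    outgoing (inj₁ refl) _  = refl
    outgoing (inj₂ refl) ≢x = contradiction refl ≢x
    paths : ∀ x i j → Incident {m} (path i) (core x) → Incident {m} (path j) (core x) →
            colour {m} (core x) (path i) ≡ colour {m} (core x) (path j) → path i ≡ (Edge m ∋ path j)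
    paths x i j p q eq with suc i Fin.≟ x | suc j Fin.≟ x
    ... | yes refl | yes refl = refl
    ... | no i≢x   | no j≢x   =
      cong (λ i → path i) (Fin.inject₁-injective (trans (outgoing p i≢x) (sym (outgoing q j≢x))))
    path≢spoke : ∀ i b → colour {m} (core zero) (path i) ≢ colour {m} (core zero) (spoke b)
    path≢spoke i true  ()
    path≢spoke i false ()
    path≢link : ∀ x i → colour {m} (core x) (path i) ≢ 2F
    path≢link x i eq with suc i Fin.≟ x
    path≢link x i () | yes _
    path≢link x i () | no _

-- The hard instance, its optimum and the adversary.

module Hard (m : ℕ) where
  open Presentation (Fin-order↔Vertex m) (Fin-edgeCount↔Edge m) src tgt src≢tgt noParallel noAntiparallel

  root : Fin (order m)
  root = vertex (core zero)

  I : Instance (order m)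
  I = unitBounds graph root

  open Instance I hiding (graph; root)

  _≟_ : DecidableEquality (Vertex m)
  _≟_ = Sum.≡-dec Fin._≟_ (Sum.≡-dec Bool._≟_ (Product.≡-dec Fin._≟_ Fin._≟_))

  -- The first three terminals force degree three at the root, so that the
  -- optimum can be computed exactly.
  terminals : List (Link m) → List (Fin (order m))
  terminals L = map (λ e → vertex (job (proj₂ e))) L ++
    vertex (pendant true) ∷ vertex (pendant false) ∷ vertex (core (suc zero)) ∷ []

  -- Walk along the path to a machine, then cross its link to the job. Used for the offline solution
  -- and for the full edge set, whose solvability `correct` presupposes.
  solves : ∀ {H L} → (∀ i → edge (path i) ∈ H) → (∀ b → edge (spoke b) ∈ H) →
           All (λ e → edge (link e) ∈ H) L → Solves H (terminals L)
  solves {H} paths spokes links = All.++⁺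
    (All.map⁺ (All.map (λ {e} e∈ → reach (suc (machine e)) ◅◅ adjacentᵒ (link e) e∈ ◅ stop) links))
    ((adjacent (spoke true) (spokes true) ◅ stop) ∷ (adjacent (spoke false) (spokes false) ◅ stop) ∷ reach (suc zero) ∷ [])
    where
    reach : ∀ x → Connected H root (vertex (core x))
    reach = <-weakInduction (λ x → Connected H root (vertex (core x))) stop
      λ i root⇝i → root⇝i ◅◅ adjacent (path i) (paths i) ◅ stop

  -- Cut off the single vertex of the job: only its two links cross.
  job-served : ∀ {H} e → Connected H root (vertex (job (proj₂ e))) → edge (link e) ∈ H ⊎ edge (link (flip e)) ∈ H
  job-served {H} e@(b , t) c with crossing (core zero) (job t) (λ v → ¬? (v ≟ job t)) c (λ ()) (λ ≢ → ≢ refl)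
  ... | path i  , _ , inj₁ (_ , ¬≢) = contradiction (λ ()) ¬≢
  ... | path i  , _ , inj₂ (_ , ¬≢) = contradiction (λ ()) ¬≢
  ... | spoke c , _ , inj₁ (_ , ¬≢) = contradiction (λ ()) ¬≢
  ... | spoke c , _ , inj₂ (_ , ¬≢) = contradiction (λ ()) ¬≢
  ... | link f  , _ , inj₁ (_ , ¬≢) = contradiction (λ ()) ¬≢
  ... | link (c , u) , f∈H , inj₂ (_ , ¬≢) with decidable-stable (job u ≟ job t) ¬≢
  ... | refl = sides b c f∈H
    where
    sides : ∀ b c → edge (link (c , t)) ∈ H → edge (link (b , t)) ∈ H ⊎ edge (link (not b , t)) ∈ H
    sides true  true  = inj₁
    sides true  false = inj₂
    sides false true  = inj₂
    sides false false = inj₁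

  spoke-forced : ∀ {H} b → Connected H root (vertex (pendant b)) → edge (spoke b) ∈ H
  spoke-forced b c with crossing (core zero) (pendant b) (λ v → ¬? (v ≟ pendant b)) c (λ ()) (λ ≢ → ≢ refl)
  ... | path i  , _ , inj₁ (_ , ¬≢) = contradiction (λ ()) ¬≢
  ... | path i  , _ , inj₂ (_ , ¬≢) = contradiction (λ ()) ¬≢
  ... | link f  , _ , inj₁ (_ , ¬≢) = contradiction (λ ()) ¬≢
  ... | link f  , _ , inj₂ (_ , ¬≢) = contradiction (λ ()) ¬≢
  ... | spoke d , _ , inj₂ (_ , ¬≢) = contradiction (λ ()) ¬≢
  ... | spoke d , d∈H , inj₁ (_ , ¬≢) with decidable-stable (pendant d ≟ pendant b) ¬≢
  ... | refl = d∈H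

  -- One side of a cut that only `path zero` crosses: spokes stay within it, and all other edges
  -- avoid it.
  Near : Vertex m → Set
  Near (core zero)    = Unit
  Near (core (suc _)) = ⊥
  Near (pendant _)    = Unit
  Near (job _)        = ⊥

  near? : Decidable Near
  near? (core zero)    = yes tt
  near? (core (suc _)) = no λ ()
  near? (pendant _)    = yes tt
  near? (job _)        = no λ ()

  path-forced : ∀ {H} → Connected H root (vertex (core (suc zero))) → edge (path zero) ∈ H
  path-forced c with crossing (core zero) (core (suc zero)) near? c tt (λ ())
  ... | path zero , e∈H , _ = e∈H
  ... | path (suc i) , _ , inj₁ (() , _)
  ... | path (suc i) , _ , inj₂ (() , _)
  ... | spoke b , _ , inj₁ (_ , ¬near) = contradiction tt ¬near
  ... | spoke b , _ , inj₂ (_ , ¬near) = contradiction tt ¬near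
  ... | link e , _ , inj₁ (() , _)
  ... | link e , _ , inj₂ (() , _)

  -- The three terminals at the end of the list force the two spokes and `path zero`, which are
  -- distinct edges at the root.
  3≤degree-root : ∀ {H} L → Solves H (terminals L) → 3 ℕ.≤ degree H root
  3≤degree-root {H} L sol with All.++⁻ʳ (map (λ e → vertex (job (proj₂ e))) L) sol
  ... | true∈ ∷ false∈ ∷ one∈ ∷ [] = subst (ℕ._≤ degree H root) hits≡3
    (hits≤degree graph root H root {es} distinct incidents)
    where
    es = edge (path zero) ∷ edge (spoke true) ∷ edge (spoke false) ∷ []
    distinct : Unique es
    distinct = Unique.map⁺ edge-injective {path zero ∷ spoke true ∷ spoke false ∷ []}
      (((λ ()) ∷ (λ ()) ∷ []) ∷ ((λ ()) ∷ []) ∷ [] ∷ [])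
    incidents : All (_∈ incident root) es
    incidents = incident⁺ (path zero) (core zero) (inj₁ refl) ∷ incident⁺ (spoke true) (core zero) (inj₁ refl)
              ∷ incident⁺ (spoke false) (core zero) (inj₁ refl) ∷ []
    hits≡3 : hits es H ≡ 3
    hits≡3 rewrite Vec.[]=⇒lookup (path-forced one∈) | Vec.[]=⇒lookup (spoke-forced true true∈)
                 | Vec.[]=⇒lookup (spoke-forced false false∈) = refl

  module _ (L : List (Link m)) (distinct : AllPairs (λ e f → machine e ≢ machine f) L) where

    offline : EdgeSet
    offline = selection (does ∘ chosen? L)

    offline-solves : Solves offline (terminals L)
    offline-solves = solves
      (λ i → selection⁺ (does ∘ chosen? L) (path i) refl)
      (λ b → selection⁺ (does ∘ chosen? L) (spoke b) refl)
      (All.tabulate λ {e} e∈ → selection⁺ (does ∘ chosen? L) (link e) (dec-true (chosen? L (link e)) e∈))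

    offline-degree : ∀ v → degree offline v ℕ.≤ 3
    offline-degree v = card-≤ (offline ∩ incident v) (λ x _ → colour (label v) (name x)) λ {x} {y} p q eq →
      name-injective (colour-injective L distinct (label v) (name x) (name y)
        (chosen p) (chosen q) (inc p) (inc q) eq)
      where
      chosen : ∀ {x} → x ∈ offline ∩ incident v → Chosen L (name x)
      chosen {x} p with chosen? L (name x) | selection⁻ (does ∘ chosen? L) (proj₁ (x∈p∩q⁻ offline (incident v) p))
      ... | yes c | _ = c
      inc : ∀ {x} → x ∈ offline ∩ incident v → Incident (name x) (label v)
      inc {x} p = incident⁻ x v (proj₂ (x∈p∩q⁻ offline (incident v) p))

    opt≡3 : IsOPT (terminals L) (+ 3 / 1)
    opt≡3 = (offline , offline-solves , ≤-antisym (maxLoad≤ graph root offline offline-degree) (3≤ offline offline-solves)) , 3≤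
      where
      3≤ : ∀ H → Solves H (terminals L) → + 3 / 1 ≤ maxLoad H
      3≤ H sol = ≤-trans (fromℕ-mono (3≤degree-root {H} L sol)) (degree≤maxLoad graph root H root)

  module _ (A : RandomizedAlgorithm (order m)) where
    open RandomizedAlgorithm A using (algorithm; expectedMaxLoad)

    prob : List (Link m) → Link m → ℝ
    prob L e = buys graph root A (terminals L) (edge (link e))

    prob-cover : ∀ e L → const 1ℚ ≼ seq (prob (e ∷ L) e) ⊕ seq (prob (e ∷ L) (flip e))
    prob-cover e L = buys-cover graph root A (terminals (e ∷ L)) (edge (link e)) (edge (link (flip e)))
      -- The job of e is the newest terminal, and each realisation of the algorithm must have
      -- connected it.
      λ ω → job-served e (All.head (OnlineAlgorithm.correct (algorithm ω) I (terminals (e ∷ L)) solvable))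
      where
      solvable : Solves ⊤ (terminals (e ∷ L))
      solvable = solves (λ _ → ∈⊤) (λ _ → ∈⊤) (All.universal (λ _ → ∈⊤) (e ∷ L))

    open Tournament prob
      (λ e L f → buys-mono graph root A (vertex (job (proj₂ e))) (terminals L) (edge (link f)))
      -- `terminals` keeps only the jobs of the links, and `flip` leaves the job unchanged.
      (λ e L f → refl) prob-cover

    -- The losses play two roles: their jobs are the requests, and their links, at distinct
    -- machines, form the cheap offline service. The gains are k distinct edges at the champion.
    adversary : ∀ k → 2 ℕ.^ k ℕ.≤ suc m → ∃ λ L → IsOPT (terminals L) (+ 3 / 1) ×
                const (fromℕ k * ¼) ≼ seq (expectedMaxLoad I (terminals L))
    adversary k 2^k≤m = losses , opt≡3 losses losses-distinct ,
      subst (λ l → const (fromℕ l * ¼) ≼ seq (expectedMaxLoad I (terminals losses)))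
        (trans (length-map _ gains) gains-length)
        (expectedMaxLoad-≥ graph root A (terminals losses) (vertex (core (suc winner))) (map (λ e → edge (link e)) gains)
          (Unique.map⁺ (λ eq → link-injective (edge-injective eq)) gains-unique)
          (All.map⁺ (All.map (λ { {e} (eq , _) → incident⁺ (link e) (core (suc winner)) (inj₂ (cong (λ x → core (suc x)) eq)) }) gains-at))
          (All.map⁺ (subst (λ J → All (λ e → const ¼ ≼ seq (prob J e)) gains) (++-identityʳ losses) gains-prob)))
      where
      open Outcome (play k 0 2^k≤m [])
      link-injective : ∀ {e f} → link e ≡ (Edge m ∋ link f) → e ≡ f
      link-injective refl = refl

-- Size of the graph and the constant.

n<2^n : ∀ n → n ℕ.< 2 ℕ.^ n
n<2^n zero    = ℕ.z<s
n<2^n (suc n) = subst (ℕ._≤ 2 ℕ.^ suc n) (ℕ.+-comm (suc n) 1)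
  (ℕ.+-mono-≤ (n<2^n n) (ℕ.≤-trans (ℕ.m^n>0 2 n) (ℕ.m≤m+n (2 ℕ.^ n) 0)))

-- With M machines the order is 3 + M², at most 4M² and hence at most M⁴. The crude bound is a pure
-- power, whose logarithm is exact when M is a power of two.
order≤⁴ : ∀ m → 2 ℕ.≤ suc m → order m ℕ.≤ (suc m ℕ.* suc m) ℕ.* (suc m ℕ.* suc m)
order≤⁴ m 2≤M = begin
  order m       ≡⟨ order≡ m ⟩
  3 ℕ.+ q       ≤⟨ ℕ.+-monoˡ-≤ q (ℕ.≤-trans 3≤q (ℕ.m≤m+n q (2 ℕ.* q))) ⟩
  3 ℕ.* q ℕ.+ q ≡⟨ ℕ.+-comm (3 ℕ.* q) q ⟩
  4 ℕ.* q       ≤⟨ ℕ.*-monoˡ-≤ q 4≤q ⟩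
  q ℕ.* q       ∎
  where
  open ℕ.≤-Reasoning
  q = suc m ℕ.* suc m
  4≤q : 4 ℕ.≤ q
  4≤q = ℕ.*-mono-≤ 2≤M 2≤M
  3≤q : 3 ℕ.≤ q
  3≤q = ℕ.≤-trans (ℕ.n≤1+n 3) 4≤q
  order≡ : ∀ m → order m ≡ 3 ℕ.+ suc m ℕ.* suc m
  order≡ = solve 1 (λ m → (con 2 :+ m) :+ (con 2 :+ (con 1 :+ m) :* m) := con 3 :+ (con 1 :+ m) :* (con 1 :+ m)) refl
    where open Data.Nat.Solver.+-*-Solver

log-order : ∀ k {m} → 1 ℕ.≤ k → suc m ≡ 2 ℕ.^ k → ⌈log₂ order m ⌉ ℕ.≤ (k ℕ.+ k) ℕ.+ (k ℕ.+ k)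
log-order k {m} 1≤k M≡2^k = begin
  ⌈log₂ order m ⌉                                      ≤⟨ ⌈log₂⌉-mono-≤ (order≤⁴ m 2≤M) ⟩
  ⌈log₂ (suc m ℕ.* suc m) ℕ.* (suc m ℕ.* suc m) ⌉      ≡⟨ cong (λ M → ⌈log₂ (M ℕ.* M) ℕ.* (M ℕ.* M) ⌉) M≡2^k ⟩
  ⌈log₂ (2^k ℕ.* 2^k) ℕ.* (2^k ℕ.* 2^k) ⌉              ≡⟨ cong (λ p → ⌈log₂ p ℕ.* p ⌉) (ℕ.^-distribˡ-+-* 2 k k) ⟨
  ⌈log₂ 2 ℕ.^ (k ℕ.+ k) ℕ.* 2 ℕ.^ (k ℕ.+ k) ⌉          ≡⟨ cong ⌈log₂_⌉ (ℕ.^-distribˡ-+-* 2 (k ℕ.+ k) (k ℕ.+ k)) ⟨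
  ⌈log₂ 2 ℕ.^ ((k ℕ.+ k) ℕ.+ (k ℕ.+ k)) ⌉              ≡⟨ ⌈log₂2^n⌉≡n ((k ℕ.+ k) ℕ.+ (k ℕ.+ k)) ⟩
  (k ℕ.+ k) ℕ.+ (k ℕ.+ k)                              ∎
  where
  open ℕ.≤-Reasoning
  2^k = 2 ℕ.^ k
  2≤M : 2 ℕ.≤ suc m
  2≤M = subst (2 ℕ.≤_) (sym M≡2^k) (ℕ.^-monoʳ-≤ 2 1≤k)

-- The constant 48 is 4 · 3 · 4: the logarithm is at most 4k, the optimum is 3, and the expected
-- load is at least k/4.
scale : ∀ {l} k → l ℕ.≤ (k ℕ.+ k) ℕ.+ (k ℕ.+ k) → + 1 / 48 * (+ l / 1) * (+ 3 / 1) ≤ fromℕ k * ¼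
scale {l} k l≤4k = begin
  + 1 / 48 * fromℕ l * (+ 3 / 1)
    ≤⟨ *-monoʳ-≤-nonNeg (+ 3 / 1) (*-monoˡ-≤-nonNeg (+ 1 / 48) (fromℕ-mono l≤4k)) ⟩
  + 1 / 48 * fromℕ ((k ℕ.+ k) ℕ.+ (k ℕ.+ k)) * (+ 3 / 1)
    ≡⟨ cong (λ q → + 1 / 48 * q * (+ 3 / 1)) (trans (fromℕ-+ (k ℕ.+ k) (k ℕ.+ k)) (cong₂ _+_ (fromℕ-+ k k) (fromℕ-+ k k))) ⟩
  + 1 / 48 * ((fromℕ k + fromℕ k) + (fromℕ k + fromℕ k)) * (+ 3 / 1)
    ≡⟨ collect (fromℕ k) ⟩
  fromℕ k * ¼ ∎
  where
  open ≤-Reasoning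
  collect : ∀ q → + 1 / 48 * ((q + q) + (q + q)) * (+ 3 / 1) ≡ q * ¼
  collect = solve 1 (λ q → con (+ 1 / 48) :* ((q :+ q) :+ (q :+ q)) :* con (+ 3 / 1) := q :* con ¼) refl
    where open +-*-Solver

theorem2 : Σ[ c ∈ ℚ ] 0ℚ < c ×
    (∀ (N : ℕ) → Σ[ n ∈ ℕ ] N ℕ.≤ n ×
    (∀ (A : RandomizedAlgorithm n) →
    Σ[ I ∈ Instance n ] Σ[ ts ∈ List (Fin n) ] Σ[ opt ∈ ℚ ]
    (∀ v → Instance.bound I v ≡ 1) ×
    Instance.IsOPT I ts opt ×
    0ℚ < opt ×
    fromℚ (c * (+ ⌈log₂ n ⌉ / 1) * opt) ≤ᴿ RandomizedAlgorithm.expectedMaxLoad A I ts))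
theorem2 = + 1 / 48 , positive⁻¹ (+ 1 / 48) , λ N →
  -- This k makes 2 ^ k exceed N and is at least 1, as `log-order` requires. There are `suc m`
  -- machines, hence the predecessor.
  let k = suc N
      m = ℕ.pred (2 ℕ.^ k)
      M≡2^k : suc m ≡ 2 ℕ.^ k
      M≡2^k = ℕ.suc-pred (2 ℕ.^ k) {{ℕ.m^n≢0 2 k}}
      N≤M : N ℕ.≤ suc m
      N≤M = subst (N ℕ.≤_) (sym M≡2^k) (ℕ.<⇒≤ (ℕ.<-trans (ℕ.n<1+n N) (n<2^n k)))
  in order m , ℕ.≤-trans N≤M (ℕ.≤-trans (ℕ.n≤1+n (suc m)) (ℕ.m≤m+n (suc (suc m)) _)) , λ A →
  let L , opt≡3 , k/4≼load = Hard.adversary m A k (ℕ.≤-reflexive (sym M≡2^k))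
  in Hard.I m , Hard.terminals m L , + 3 / 1 , (λ _ → refl) , opt≡3 , positive⁻¹ (+ 3 / 1) ,
     eventually (≼-trans (≤⇒≼ λ _ → scale k (log-order k (ℕ.s≤s ℕ.z≤n) M≡2^k)) k/4≼load)
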